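{- There exist absolute constants $c, c'>0$ such that for every prime power $q$, if $P$ is a point set of size at least $cq$ in $\mathbb{F}_q^3$, then $P$ contains at least $c'|P|^4/q$ critical coplanar $4$-tuples.
   Context: $\mathbb{F}_q$ is the finite field with $q$ elements. A $k$-tuple means an unordered set of $k$ distinct points. A plane in $\mathbb{F}_q^3$ is a $2$-dimensional affine subspace. A coplanar $4$-tuple is a set of $4$ points of $\mathbb{F}_q^3$ contained in some plane; it is critical if every proper subset of it is affinely independent (equivalently, no three of its points are collinear). -}

module Defs where

open import Level using (0ℓ)
open import Data.Nat using (ℕ; _<_)
open import Data.Integer using (+_)
open import Data.Rational using (ℚ; _/_)
open import Data.Fin using (Fin) renaming (_<_ to _<ᶠ_)
open import Data.List using (List; length; lookup)
open import Data.List.Membership.Propositional using (_∈_)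
open import Data.List.Relation.Unary.Unique.Propositional using (Unique)
open import Data.Product using (Σ; ∃; _×_; _,_)
open import Relation.Binary.PropositionalEquality using (_≡_; _≢_)
open import Algebra.Structures using (IsCommutativeRing)

toℚ : ℕ → ℚ
toℚ n = (+ n) / 1

record FiniteField : Set₁ where
  infixl 6 _+_
  infixl 7 _*_
  field
    Carrier : Set
    _+_ _*_ : Carrier → Carrier → Carrier
    -_ : Carrier → Carrier
    0# 1# : Carrier
    isCommutativeRing : IsCommutativeRing _≡_ _+_ _*_ -_ 0# 1#
    0≢1 : 0# ≢ 1#
    inverse : ∀ x → x ≢ 0# → ∃ λ y → x * y ≡ 1#
    elements : List Carrier
    elements-unique : Unique elements
    elements-complete : ∀ x → x ∈ elements

  size : ℕ
  size = length elements

module Geometry (F : FiniteField) where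
  open FiniteField F

  record Pt : Set where
    constructor pt
    field
      x₁ x₂ x₃ : Carrier

  _⊕_ : Pt → Pt → Pt
  pt a b c ⊕ pt a' b' c' = pt (a + a') (b + b') (c + c')

  _⊖_ : Pt → Pt → Pt
  pt a b c ⊖ pt a' b' c' = pt (a + - a') (b + - b') (c + - c')

  _·_ : Carrier → Pt → Pt
  s · pt a b c = pt (s * a) (s * b) (s * c)

  𝟎 : Pt
  𝟎 = pt 0# 0# 0#

  LinIndep₂ : Pt → Pt → Set
  LinIndep₂ u v = ∀ s t → (s · u) ⊕ (t · v) ≡ 𝟎 → (s ≡ 0#) × (t ≡ 0#)

  record Plane : Set where
    constructor plane
    field
      base : Pt
      dir₁ dir₂ : Pt
      indep : LinIndep₂ dir₁ dir₂

  _∈Plane_ : Pt → Plane → Set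
  x ∈Plane plane p u v _ = ∃ λ s → ∃ λ t → x ≡ (p ⊕ (s · u)) ⊕ (t · v)

  Coplanar : Pt → Pt → Pt → Pt → Set
  Coplanar a b c d = Σ Plane λ H → (a ∈Plane H) × (b ∈Plane H) × (c ∈Plane H) × (d ∈Plane H)

  AffIndep₃ : Pt → Pt → Pt → Set
  AffIndep₃ a b c = LinIndep₂ (b ⊖ a) (c ⊖ a)

  AffIndep₂ : Pt → Pt → Set
  AffIndep₂ a b = ∀ s → s · (b ⊖ a) ≡ 𝟎 → s ≡ 0#

  -- every proper subset of {a,b,c,d} is affinely independent
  -- (singletons and ∅ are always affinely independent)
  Critical : Pt → Pt → Pt → Pt → Set
  Critical a b c d =
    AffIndep₂ a b × AffIndep₂ a c × AffIndep₂ a d ×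
    AffIndep₂ b c × AffIndep₂ b d × AffIndep₂ c d ×
    AffIndep₃ a b c × AffIndep₃ a b d × AffIndep₃ a c d × AffIndep₃ b c d

  -- a 4-subset of a duplicate-free list P, encoded as strictly increasing indices
  record Quad (n : ℕ) : Set where
    constructor quad
    field
      i j k l : Fin n
      i<j : i <ᶠ j
      j<k : j <ᶠ k
      k<l : k <ᶠ l

  CriticalCoplanarQuad : (P : List Pt) → Quad (length P) → Set
  CriticalCoplanarQuad P (quad i j k l _ _ _) =
    Coplanar (lookup P i) (lookup P j) (lookup P k) (lookup P l) ×
    Critical (lookup P i) (lookup P j) (lookup P k) (lookup P l)

  CCQuadList : (P : List Pt) → List (Quad (length P)) → Set
  CCQuadList P T = Unique T × (∀ {Q} → Q ∈ T → CriticalCoplanarQuad P Q)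

{-# OPTIONS --safe #-}
module Submission where

-- Call a pair of points of P rich if its line contains a third point of P.  In
-- every non-collinear triple mark the rich sides, or all sides if none is rich.
-- By Cauchy–Schwarz over the q + 1 planes through a side, there are ≫ |P|⁴/q
-- coplanar quadruples consisting of two triangles on a common marked side {a, c}.
-- With b, d the two apices, such a quadruple can only fail to be critical if
-- b = d, or if one of a, c lies on the line bd.  The former is rare as |P| ≥ cq.
-- In the latter case, say a ∈ bd, the side {a, b} is rich, hence so is {a, c};
-- replacing a by a third point a′ of the line ac makes the quadruple critical.
-- As a is determined by a′, b, c, d, there are at least as many critical
-- quadruples as such failures.

open import Defs
open import Level using (0ℓ)
open import Algebra.Bundles using (CommutativeRing)
import Algebra.Properties.Ring as RingProperties
import Algebra.Properties.Semiring.Mult as SemiringMult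
import Algebra.Solver.Ring as RingSolver
open import Algebra.Solver.Ring.AlmostCommutativeRing using (fromCommutativeRing; _-Raw-AlmostCommutative⟶_)
open import Data.Bool using (if_then_else_)
open import Data.Fin using (Fin; zero; suc)
open import Data.Fin.Properties using (any?; toℕ<n; suc-injective; 0≢1+n) renaming (_≟_ to _≟ᶠ_)
import Data.Integer as ℤ
import Data.Integer.Properties as ℤ
open import Data.List using (List; []; _∷_; length; lookup; map; _++_; filter; tabulate; allFin; cartesianProduct)
open import Data.List.Membership.Propositional using (_∈_)
open import Data.List.Membership.Propositional.Properties using (∈-lookup)
open import Data.List.Properties using (filter-++; length-++; length-map)
open import Data.List.Relation.Unary.All as All using (All; []; _∷_; reduce)
open import Data.List.Relation.Unary.All.Properties using (all-filter)
open import Data.List.Relation.Unary.AllPairs using ([]; _∷_)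
open import Data.List.Relation.Unary.Any using (here; there; index)
open import Data.List.Relation.Unary.Any.Properties using (lookup-index)
open import Data.List.Relation.Unary.Unique.Propositional using (Unique)
import Data.List.Relation.Unary.Unique.Propositional.Properties as Unique
open import Data.Maybe using (Maybe) renaming (map to mapMaybe)
open import Data.Nat using (ℕ; zero; suc)
import Data.Nat as ℕ
import Data.Nat.Properties as ℕ
open import Data.Product using (Σ; ∃; _×_; _,_; proj₁; proj₂)
import Data.Rational as ℚ
import Data.Rational.Properties as ℚ
import Data.Rational.Unnormalised as ℚᵘ
import Data.Rational.Unnormalised.Properties as ℚᵘ
open import Data.Sign as Sign using (Sign)
open import Data.Sum using (_⊎_; inj₁; inj₂)
open import Function using (_∘_; id)
open import Relation.Binary.Consequences using (dec⇒weaklyDec)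
open import Relation.Binary.Definitions using (DecidableEquality; tri<; tri≈; tri>)
open import Relation.Binary.PropositionalEquality using (_≡_; _≢_; refl; sym; trans; cong; cong₂; subst; module ≡-Reasoning)
open import Relation.Nullary using (¬_; Dec; yes; no; does; contradiction)
open import Relation.Nullary.Decidable using (map′; _×-dec_; _⊎-dec_; ¬?)
open import Relation.Unary using (Pred; Decidable)

-- The obstacle is that a collinear triple is coplanar with every fourth point. If P is a union of
-- boundedly many full lines, a positive proportion of all quadruples contain a collinear triple,
-- far more than |P|⁴/q. A lower bound of this order for coplanar quadruples alone therefore says
-- nothing about critical ones. Marking discards the degenerate pairs of triangles whose common side
-- offers no third point to which an end could be moved. Every non-collinear triple still keeps at
-- least one marked side, so only a constant factor is lost. The quadruples are counted in ordered
-- form. Coplanarity is the vanishing of a determinant throughout the count and becomes an actual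
-- plane only for the final quadruples.

-- Polynomial identities with integer coefficients in a commutative ring.

module IntegerCoefficients (R : CommutativeRing 0ℓ 0ℓ) where
  open CommutativeRing R renaming (refl to ≈-refl; sym to ≈-sym; trans to ≈-trans)
  open RingProperties ring using (-0#≈0#; -‿+-comm; -‿involutive; -‿distribˡ-*; -‿distribʳ-*)
  open SemiringMult semiring using (×-homo-+; ×1-homo-*) renaming (_×_ to _×ₙ_)
  open import Relation.Binary.Reasoning.Setoid setoid

  -- The canonical homomorphism from the integers. Integer coefficients are compared by evaluation,
  -- so the solver can cancel opposite monomials although the ring elements are opaque.
  ⟦_⟧ℤ : ℤ.ℤ → Carrier
  ⟦ ℤ.+ n ⟧ℤ = n ×ₙ 1#
  ⟦ ℤ.-[1+ n ] ⟧ℤ = - (suc n ×ₙ 1#)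

  ⊖-homo : ∀ m n → ⟦ m ℤ.⊖ n ⟧ℤ ≈ m ×ₙ 1# - n ×ₙ 1#
  ⊖-homo m zero = ≈-trans (≈-sym (+-identityʳ _)) (+-congˡ (≈-sym -0#≈0#))
  ⊖-homo zero (suc n) = ≈-sym (+-identityˡ _)
  ⊖-homo (suc m) (suc n) = begin
    ⟦ suc m ℤ.⊖ suc n ⟧ℤ                  ≡⟨ cong ⟦_⟧ℤ (ℤ.[1+m]⊖[1+n]≡m⊖n m n) ⟩
    ⟦ m ℤ.⊖ n ⟧ℤ                          ≈⟨ ⊖-homo m n ⟩
    m ×ₙ 1# - n ×ₙ 1#                     ≈⟨ +-congʳ (+-identityʳ _) ⟨
    m ×ₙ 1# + 0# - n ×ₙ 1#                ≈⟨ +-congʳ (+-congˡ (-‿inverseʳ 1#)) ⟨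
    m ×ₙ 1# + (1# - 1#) - n ×ₙ 1#         ≈⟨ +-congʳ (+-assoc _ _ _) ⟨
    m ×ₙ 1# + 1# - 1# - n ×ₙ 1#           ≈⟨ +-assoc _ _ _ ⟩
    m ×ₙ 1# + 1# + (- 1# - n ×ₙ 1#)       ≈⟨ +-cong (+-comm _ _) (-‿+-comm _ _) ⟩
    suc m ×ₙ 1# - suc n ×ₙ 1#             ∎

  +-homo : ∀ i j → ⟦ i ℤ.+ j ⟧ℤ ≈ ⟦ i ⟧ℤ + ⟦ j ⟧ℤ
  +-homo (ℤ.+ m) (ℤ.+ n) = ×-homo-+ 1# m n
  +-homo (ℤ.+ m) ℤ.-[1+ n ] = ⊖-homo m (suc n)
  +-homo ℤ.-[1+ m ] (ℤ.+ n) = ≈-trans (⊖-homo n (suc m)) (+-comm _ _)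
  +-homo ℤ.-[1+ m ] ℤ.-[1+ n ] = begin
    - (suc (suc (m ℕ.+ n)) ×ₙ 1#)         ≡⟨ cong (λ k → - (k ×ₙ 1#)) (cong suc (ℕ.+-suc m n)) ⟨
    - ((suc m ℕ.+ suc n) ×ₙ 1#)           ≈⟨ -‿cong (×-homo-+ 1# (suc m) (suc n)) ⟩
    - (suc m ×ₙ 1# + suc n ×ₙ 1#)         ≈⟨ -‿+-comm _ _ ⟨
    - (suc m ×ₙ 1#) - suc n ×ₙ 1#         ∎

  neg-homo : ∀ i → ⟦ ℤ.- i ⟧ℤ ≈ - ⟦ i ⟧ℤ
  neg-homo (ℤ.+ zero) = ≈-sym -0#≈0#
  neg-homo (ℤ.+ suc n) = ≈-refl
  neg-homo ℤ.-[1+ n ] = ≈-sym (-‿involutive _)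

  ◃-homo-+ : ∀ n → ⟦ Sign.+ ℤ.◃ n ⟧ℤ ≈ n ×ₙ 1#
  ◃-homo-+ n = reflexive (cong ⟦_⟧ℤ (ℤ.+◃n≡+n n))

  ◃-homo-- : ∀ n → ⟦ Sign.- ℤ.◃ n ⟧ℤ ≈ - (n ×ₙ 1#)
  ◃-homo-- n = ≈-trans (reflexive (cong ⟦_⟧ℤ (ℤ.-◃n≡-n n))) (neg-homo (ℤ.+ n))

  *-homo : ∀ i j → ⟦ i ℤ.* j ⟧ℤ ≈ ⟦ i ⟧ℤ * ⟦ j ⟧ℤ
  *-homo (ℤ.+ m) (ℤ.+ n) = ≈-trans (◃-homo-+ (m ℕ.* n)) (×1-homo-* m n)
  *-homo (ℤ.+ m) ℤ.-[1+ n ] = begin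
    ⟦ Sign.- ℤ.◃ (m ℕ.* suc n) ⟧ℤ         ≈⟨ ◃-homo-- (m ℕ.* suc n) ⟩
    - ((m ℕ.* suc n) ×ₙ 1#)               ≈⟨ -‿cong (×1-homo-* m (suc n)) ⟩
    - (m ×ₙ 1# * (suc n ×ₙ 1#))           ≈⟨ -‿distribʳ-* _ _ ⟩
    m ×ₙ 1# * - (suc n ×ₙ 1#)             ∎
  *-homo ℤ.-[1+ m ] (ℤ.+ n) = begin
    ⟦ Sign.- ℤ.◃ (suc m ℕ.* n) ⟧ℤ         ≈⟨ ◃-homo-- (suc m ℕ.* n) ⟩
    - ((suc m ℕ.* n) ×ₙ 1#)               ≈⟨ -‿cong (×1-homo-* (suc m) n) ⟩
    - (suc m ×ₙ 1# * (n ×ₙ 1#))           ≈⟨ -‿distribˡ-* _ _ ⟩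
    - (suc m ×ₙ 1#) * (n ×ₙ 1#)           ∎
  *-homo ℤ.-[1+ m ] ℤ.-[1+ n ] = begin
    ⟦ Sign.+ ℤ.◃ (suc m ℕ.* suc n) ⟧ℤ     ≈⟨ ◃-homo-+ (suc m ℕ.* suc n) ⟩
    (suc m ℕ.* suc n) ×ₙ 1#               ≈⟨ ×1-homo-* (suc m) (suc n) ⟩
    suc m ×ₙ 1# * (suc n ×ₙ 1#)           ≈⟨ -‿involutive _ ⟨
    - - (suc m ×ₙ 1# * (suc n ×ₙ 1#))     ≈⟨ -‿cong (-‿distribʳ-* _ _) ⟩
    - (suc m ×ₙ 1# * - (suc n ×ₙ 1#))     ≈⟨ -‿distribˡ-* _ _ ⟩
    - (suc m ×ₙ 1#) * - (suc n ×ₙ 1#)     ∎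

  morphism : ℤ.+-*-rawRing -Raw-AlmostCommutative⟶ fromCommutativeRing R
  morphism = record
    { ⟦_⟧ = ⟦_⟧ℤ ; +-homo = +-homo ; *-homo = *-homo ; -‿homo = neg-homo
    ; 0-homo = ≈-refl ; 1-homo = +-identityʳ 1# }

  _coeff≟_ : ∀ i j → Maybe (⟦ i ⟧ℤ ≈ ⟦ j ⟧ℤ)
  i coeff≟ j = mapMaybe (λ i≡j → reflexive (cong ⟦_⟧ℤ i≡j)) (dec⇒weaklyDec ℤ._≟_ i j)

  open RingSolver ℤ.+-*-rawRing (fromCommutativeRing R) morphism _coeff≟_ public
    using (solve; _:=_; _:+_; _:*_; :-_; con; Polynomial)

-- Arithmetic of the finite field and of its three-dimensional space.

module FieldGeometry (F : FiniteField) where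
  open FiniteField F
  open Geometry F public
  open Pt

  ring : CommutativeRing 0ℓ 0ℓ
  ring = record { isCommutativeRing = isCommutativeRing }

  open CommutativeRing ring using (*-comm; *-identityˡ; *-identityʳ; zeroˡ; zeroʳ; +-assoc; +-identityʳ)
  open IntegerCoefficients ring

  elementIndex : Carrier → Fin size
  elementIndex x = index (elements-complete x)

  elementIndex-injective : ∀ {x y} → elementIndex x ≡ elementIndex y → x ≡ y
  elementIndex-injective {x} {y} eq =
    trans (lookup-index (elements-complete x))
      (trans (cong (lookup elements) eq) (sym (lookup-index (elements-complete y))))

  1≤size : 1 ℕ.≤ size
  1≤size = ℕ.≤-trans (ℕ.s≤s ℕ.z≤n) (toℕ<n (elementIndex 0#))

  -- Decidability comes from the enumeration: an element is determined by its position in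
  -- `elements`.
  _≟_ : DecidableEquality Carrier
  x ≟ y = map′ elementIndex-injective (cong elementIndex) (elementIndex x ≟ᶠ elementIndex y)

  pt-≡ : ∀ {p q} → x₁ p ≡ x₁ q → x₂ p ≡ x₂ q → x₃ p ≡ x₃ q → p ≡ q
  pt-≡ refl refl refl = refl

  _≟ₚ_ : DecidableEquality Pt
  p ≟ₚ q = map′ (λ (e₁ , e₂ , e₃) → pt-≡ e₁ e₂ e₃) (λ { refl → refl , refl , refl })
    (x₁ p ≟ x₁ q ×-dec x₂ p ≟ x₂ q ×-dec x₃ p ≟ x₃ q)

  *-cancelˡ-0 : ∀ {x y} → x ≢ 0# → x * y ≡ 0# → y ≡ 0#
  *-cancelˡ-0 {x} {y} x≢0 xy≡0 with i , xi≡1 ← inverse x x≢0 = begin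
    y            ≡⟨ *-identityʳ y ⟨
    y * 1#       ≡⟨ cong (y *_) xi≡1 ⟨
    y * (x * i)  ≡⟨ solve 3 (λ x y i → y :* (x :* i) := (x :* y) :* i) refl x y i ⟩
    x * y * i    ≡⟨ cong (_* i) xy≡0 ⟩
    0# * i       ≡⟨ zeroˡ i ⟩
    0#           ∎
    where open ≡-Reasoning

  x+0≡x : ∀ {x y} → y ≡ 0# → x + y ≡ x
  x+0≡x {x} refl = +-identityʳ x

  -‿0 : ∀ {x} → x ≡ 0# → - x ≡ 0#
  -‿0 refl = solve 0 (:- con (ℤ.+ 0) := con (ℤ.+ 0)) refl

  *-zeroʳ : ∀ {x y} → y ≡ 0# → x * y ≡ 0#
  *-zeroʳ {x} refl = zeroʳ x

  *-zeroˡ : ∀ {x y} → x ≡ 0# → x * y ≡ 0#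
  *-zeroˡ {_} {y} refl = zeroˡ y

  +-rotate : ∀ a b c → a + b + c ≡ b + c + a
  +-rotate = solve 3 (λ a b c → a :+ b :+ c := b :+ c :+ a) refl

  x-y≡0⇒x≡y : ∀ {x y} → x + - y ≡ 0# → x ≡ y
  x-y≡0⇒x≡y {x} {y} e = begin
    x            ≡⟨ solve 2 (λ x y → x := y :+ (x :+ :- y)) refl x y ⟩
    y + (x + - y) ≡⟨ x+0≡x e ⟩
    y ∎
    where open ≡-Reasoning

  x≡y⇒x-y≡0 : ∀ {x y} → x ≡ y → x + - y ≡ 0#
  x≡y⇒x-y≡0 {x} refl = solve 1 (λ x → x :+ :- x := con (ℤ.+ 0)) refl x

  ⊖≡𝟎⇒≡ : ∀ {a b} → b ⊖ a ≡ 𝟎 → a ≡ b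
  ⊖≡𝟎⇒≡ e = sym (pt-≡ (x-y≡0⇒x≡y (cong x₁ e)) (x-y≡0⇒x≡y (cong x₂ e)) (x-y≡0⇒x≡y (cong x₃ e)))

  ⊕-⊖ : ∀ a b → b ≡ a ⊕ (b ⊖ a)
  ⊕-⊖ a b = pt-≡ (c (x₁ a) (x₁ b)) (c (x₂ a) (x₂ b)) (c (x₃ a) (x₃ b))
    where
    c : ∀ a b → b ≡ a + (b + - a)
    c = solve 2 (λ a b → b := a :+ (b :+ :- a)) refl

  -- Cross products, determinants and linear dependence.

  cross : Pt → Pt → Pt
  cross (pt u₁ u₂ u₃) (pt w₁ w₂ w₃) =
    pt (u₂ * w₃ + - (u₃ * w₂)) (u₃ * w₁ + - (u₁ * w₃)) (u₁ * w₂ + - (u₂ * w₁))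

  dot : Pt → Pt → Carrier
  dot (pt u₁ u₂ u₃) (pt w₁ w₂ w₃) = u₁ * w₁ + u₂ * w₂ + u₃ * w₃

  det : Pt → Pt → Pt → Carrier
  det u w v = dot (cross u w) v

  data NonzeroCoordinate (u : Pt) : Set where
    first  : x₁ u ≢ 0# → NonzeroCoordinate u
    second : x₂ u ≢ 0# → NonzeroCoordinate u
    third  : x₃ u ≢ 0# → NonzeroCoordinate u

  nonzeroCoordinate : ∀ u → u ≢ 𝟎 → NonzeroCoordinate u
  nonzeroCoordinate u u≢𝟎 with x₁ u ≟ 0# | x₂ u ≟ 0# | x₃ u ≟ 0#
  ... | no ≢0  | _      | _      = first ≢0
  ... | yes _  | no ≢0  | _      = second ≢0
  ... | yes _  | yes _  | no ≢0  = third ≢0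
  ... | yes e₁ | yes e₂ | yes e₃ = contradiction (pt-≡ e₁ e₂ e₃) u≢𝟎

  ·-cancelʳ-𝟎 : ∀ {s u} → u ≢ 𝟎 → s · u ≡ 𝟎 → s ≡ 0#
  ·-cancelʳ-𝟎 {s} {u} u≢𝟎 su≡𝟎 with nonzeroCoordinate u u≢𝟎
  ... | first  ≢0 = *-cancelˡ-0 ≢0 (trans (*-comm _ _) (cong x₁ su≡𝟎))
  ... | second ≢0 = *-cancelˡ-0 ≢0 (trans (*-comm _ _) (cong x₂ su≡𝟎))
  ... | third  ≢0 = *-cancelˡ-0 ≢0 (trans (*-comm _ _) (cong x₃ su≡𝟎))

  -- Crossing the relation su + tw = 0 with w and with u leaves s(u × w) = 0 and t(u × w) = 0.
  linIndep₂ : ∀ {u w} → cross u w ≢ 𝟎 → LinIndep₂ u w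
  linIndep₂ {u} {w} n≢𝟎 s t e =
    ·-cancelʳ-𝟎 n≢𝟎 (pt-≡ (left u₂ w₂ u₃ w₃ e₂ e₃) (left u₃ w₃ u₁ w₁ e₃ e₁) (left u₁ w₁ u₂ w₂ e₁ e₂)) ,
    ·-cancelʳ-𝟎 n≢𝟎 (pt-≡ (right u₂ w₂ u₃ w₃ e₂ e₃) (right u₃ w₃ u₁ w₁ e₃ e₁) (right u₁ w₁ u₂ w₂ e₁ e₂))
    where
    open ≡-Reasoning
    open Pt u using () renaming (x₁ to u₁; x₂ to u₂; x₃ to u₃)
    open Pt w using () renaming (x₁ to w₁; x₂ to w₂; x₃ to w₃)
    e₁ = cong x₁ e
    e₂ = cong x₂ e
    e₃ = cong x₃ e
    left : ∀ u w u′ w′ → s * u + t * w ≡ 0# → s * u′ + t * w′ ≡ 0# → s * (u * w′ + - (u′ * w)) ≡ 0#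
    left u w u′ w′ e e′ = begin
      s * (u * w′ + - (u′ * w))
        ≡⟨ solve 6 (λ s t u w u′ w′ → s :* (u :* w′ :+ :- (u′ :* w)) :=
             w′ :* (s :* u :+ t :* w) :+ :- (w :* (s :* u′ :+ t :* w′))) refl s t u w u′ w′ ⟩
      w′ * (s * u + t * w) + - (w * (s * u′ + t * w′))
        ≡⟨ x≡y⇒x-y≡0 (trans (*-zeroʳ e) (sym (*-zeroʳ e′))) ⟩
      0# ∎
    right : ∀ u w u′ w′ → s * u + t * w ≡ 0# → s * u′ + t * w′ ≡ 0# → t * (u * w′ + - (u′ * w)) ≡ 0#
    right u w u′ w′ e e′ = begin
      t * (u * w′ + - (u′ * w))
        ≡⟨ solve 6 (λ s t u w u′ w′ → t :* (u :* w′ :+ :- (u′ :* w)) :=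
             u :* (s :* u′ :+ t :* w′) :+ :- (u′ :* (s :* u :+ t :* w))) refl s t u w u′ w′ ⟩
      u * (s * u′ + t * w′) + - (u′ * (s * u + t * w))
        ≡⟨ x≡y⇒x-y≡0 (trans (*-zeroʳ e′) (sym (*-zeroʳ e))) ⟩
      0# ∎

  -- The factor is the ratio of w to u in a nonzero coordinate of u; the vanishing minors force the
  -- same ratio in the other two.
  cross≡𝟎⇒multiple : ∀ {u w} → u ≢ 𝟎 → cross u w ≡ 𝟎 → ∃ λ s → w ≡ s · u
  cross≡𝟎⇒multiple {u} {w} u≢𝟎 n≡𝟎 = go (nonzeroCoordinate u u≢𝟎)
    where
    open ≡-Reasoning
    open Pt u using () renaming (x₁ to u₁; x₂ to u₂; x₃ to u₃)
    open Pt w using () renaming (x₁ to w₁; x₂ to w₂; x₃ to w₃)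
    n₁ = x-y≡0⇒x≡y (cong x₁ n≡𝟎)
    n₂ = x-y≡0⇒x≡y (cong x₂ n≡𝟎)
    n₃ = x-y≡0⇒x≡y (cong x₃ n≡𝟎)
    ratio : ∀ {u u′ w w′ i} → u * i ≡ 1# → u * w′ ≡ u′ * w → w′ ≡ w * i * u′
    ratio {u} {u′} {w} {w′} {i} ui≡1 e = begin
      w′            ≡⟨ *-identityʳ w′ ⟨
      w′ * 1#       ≡⟨ cong (w′ *_) ui≡1 ⟨
      w′ * (u * i)  ≡⟨ solve 3 (λ w′ u i → w′ :* (u :* i) := i :* (u :* w′)) refl w′ u i ⟩
      i * (u * w′)  ≡⟨ cong (i *_) e ⟩
      i * (u′ * w)  ≡⟨ solve 3 (λ w u′ i → i :* (u′ :* w) := w :* i :* u′) refl w u′ i ⟩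
      w * i * u′    ∎
    go : NonzeroCoordinate u → ∃ λ s → w ≡ s · u
    go (first ≢0) with i , e ← inverse u₁ ≢0 =
      w₁ * i , pt-≡ (ratio e refl) (ratio e n₃) (ratio e (sym n₂))
    go (second ≢0) with i , e ← inverse u₂ ≢0 =
      w₂ * i , pt-≡ (ratio e (sym n₃)) (ratio e refl) (ratio e n₁)
    go (third ≢0) with i , e ← inverse u₃ ≢0 =
      w₃ * i , pt-≡ (ratio e n₂) (ratio e (sym n₁)) (ratio e refl)

  scale-combination : ∀ {n i s t u w v} → n * i ≡ 1# → n * v ≡ s * u + t * w → v ≡ s * i * u + t * i * w
  scale-combination {n} {i} {s} {t} {u} {w} {v} ni≡1 e = begin
    v                      ≡⟨ *-identityʳ v ⟨
    v * 1#                 ≡⟨ cong (v *_) ni≡1 ⟨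
    v * (n * i)            ≡⟨ solve 3 (λ v n i → v :* (n :* i) := n :* v :* i) refl v n i ⟩
    n * v * i              ≡⟨ cong (_* i) e ⟩
    (s * u + t * w) * i    ≡⟨ solve 5 (λ i s t u w → (s :* u :+ t :* w) :* i := s :* i :* u :+ t :* i :* w) refl i s t u w ⟩
    s * i * u + t * i * w  ∎
    where open ≡-Reasoning

  cramer : ∀ u₁ u₂ w₁ w₂ v₁ v₂ →
    (u₁ * w₂ + - (u₂ * w₁)) * v₁ ≡ (v₁ * w₂ + - (v₂ * w₁)) * u₁ + (u₁ * v₂ + - (u₂ * v₁)) * w₁
  cramer = solve 6 (λ u₁ u₂ w₁ w₂ v₁ v₂ →
    (u₁ :* w₂ :+ :- (u₂ :* w₁)) :* v₁ :=
    (v₁ :* w₂ :+ :- (v₂ :* w₁)) :* u₁ :+ (u₁ :* v₂ :+ :- (u₂ :* v₁)) :* w₁) refl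

  cramer′ : ∀ u₁ u₂ w₁ w₂ v₁ v₂ →
    (u₁ * w₂ + - (u₂ * w₁)) * v₂ ≡ (v₁ * w₂ + - (v₂ * w₁)) * u₂ + (u₁ * v₂ + - (u₂ * v₁)) * w₂
  cramer′ = solve 6 (λ u₁ u₂ w₁ w₂ v₁ v₂ →
    (u₁ :* w₂ :+ :- (u₂ :* w₁)) :* v₂ :=
    (v₁ :* w₂ :+ :- (v₂ :* w₁)) :* u₂ :+ (u₁ :* v₂ :+ :- (u₂ :* v₁)) :* w₂) refl

  -- The difference of the two sides is exactly the determinant, so the third coordinate obeys the
  -- relation that Cramer's rule gives for the first two.
  cramer-det : ∀ u₁ u₂ u₃ w₁ w₂ w₃ v₁ v₂ v₃ →
    (u₂ * w₃ + - (u₃ * w₂)) * v₁ + (u₃ * w₁ + - (u₁ * w₃)) * v₂ + (u₁ * w₂ + - (u₂ * w₁)) * v₃ ≡ 0# →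
    (u₁ * w₂ + - (u₂ * w₁)) * v₃ ≡ (v₁ * w₂ + - (v₂ * w₁)) * u₃ + (u₁ * v₂ + - (u₂ * v₁)) * w₃
  cramer-det u₁ u₂ u₃ w₁ w₂ w₃ v₁ v₂ v₃ d≡0 = x-y≡0⇒x≡y (trans
    (solve 9 (λ u₁ u₂ u₃ w₁ w₂ w₃ v₁ v₂ v₃ →
      (u₁ :* w₂ :+ :- (u₂ :* w₁)) :* v₃ :+
        :- ((v₁ :* w₂ :+ :- (v₂ :* w₁)) :* u₃ :+ (u₁ :* v₂ :+ :- (u₂ :* v₁)) :* w₃) :=
      (u₂ :* w₃ :+ :- (u₃ :* w₂)) :* v₁ :+ (u₃ :* w₁ :+ :- (u₁ :* w₃)) :* v₂ :+
        (u₁ :* w₂ :+ :- (u₂ :* w₁)) :* v₃)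
      refl u₁ u₂ u₃ w₁ w₂ w₃ v₁ v₂ v₃) d≡0)

  -- A nonzero 2 × 2 minor solves for the coefficients in two coordinates, and the vanishing
  -- determinant gives the remaining one. The three cases differ by a cyclic shift of coordinates.
  det≡0⇒combination : ∀ {u w v} → cross u w ≢ 𝟎 → det u w v ≡ 0# →
                      ∃ λ s → ∃ λ t → v ≡ (s · u) ⊕ (t · w)
  det≡0⇒combination {pt u₁ u₂ u₃} {pt w₁ w₂ w₃} {pt v₁ v₂ v₃} n≢𝟎 d≡0 = go (nonzeroCoordinate _ n≢𝟎)
    where
    u = pt u₁ u₂ u₃
    w = pt w₁ w₂ w₃
    go : NonzeroCoordinate (cross u w) → ∃ λ s → ∃ λ t → pt v₁ v₂ v₃ ≡ (s · u) ⊕ (t · w)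
    go (third ≢0) with i , e ← inverse (u₁ * w₂ + - (u₂ * w₁)) ≢0
      = _ , _ , pt-≡
          (scale-combination e (cramer u₁ u₂ w₁ w₂ v₁ v₂))
          (scale-combination e (cramer′ u₁ u₂ w₁ w₂ v₁ v₂))
          (scale-combination e (cramer-det u₁ u₂ u₃ w₁ w₂ w₃ v₁ v₂ v₃ d≡0))
    go (first ≢0) with i , e ← inverse (u₂ * w₃ + - (u₃ * w₂)) ≢0
      = _ , _ , pt-≡
          (scale-combination e (cramer-det u₂ u₃ u₁ w₂ w₃ w₁ v₂ v₃ v₁ (trans (sym (+-rotate _ _ _)) d≡0)))
          (scale-combination e (cramer u₂ u₃ w₂ w₃ v₂ v₃))
          (scale-combination e (cramer′ u₂ u₃ w₂ w₃ v₂ v₃))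
    go (second ≢0) with i , e ← inverse (u₃ * w₁ + - (u₁ * w₃)) ≢0
      = _ , _ , pt-≡
          (scale-combination e (cramer′ u₃ u₁ w₃ w₁ v₃ v₁))
          (scale-combination e (cramer-det u₃ u₁ u₂ w₃ w₁ w₂ v₃ v₁ v₂ (trans (+-rotate _ _ _) d≡0)))
          (scale-combination e (cramer u₃ u₁ w₃ w₁ v₃ v₁))

  -- Collinear triples.

  -- Triples with a repeated point count as collinear, so the negation also carries the distinctness
  -- of the three points.
  Collinear : Pt → Pt → Pt → Set
  Collinear a b c = cross (b ⊖ a) (c ⊖ a) ≡ 𝟎

  collinear? : ∀ a b c → Dec (Collinear a b c)
  collinear? a b c = cross (b ⊖ a) (c ⊖ a) ≟ₚ 𝟎

  collinear-swap₂₃ : ∀ {a b c} → Collinear a b c → Collinear a c b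
  collinear-swap₂₃ e = pt-≡ (flip (cong x₁ e)) (flip (cong x₂ e)) (flip (cong x₃ e))
    where
    flip : ∀ {u u′ w w′} → u * w′ + - (u′ * w) ≡ 0# → w * u′ + - (w′ * u) ≡ 0#
    flip {u} {u′} {w} {w′} e = trans
      (solve 4 (λ u u′ w w′ → w :* u′ :+ :- (w′ :* u) := :- (u :* w′ :+ :- (u′ :* w))) refl u u′ w w′)
      (-‿0 e)

  collinear-swap₁₂ : ∀ {a b c} → Collinear a b c → Collinear b a c
  collinear-swap₁₂ {a} {b} {c} e = pt-≡
    (flip (x₂ a) (x₃ a) (x₂ b) (x₃ b) (x₂ c) (x₃ c) (cong x₁ e))
    (flip (x₃ a) (x₁ a) (x₃ b) (x₁ b) (x₃ c) (x₁ c) (cong x₂ e))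
    (flip (x₁ a) (x₂ a) (x₁ b) (x₂ b) (x₁ c) (x₂ c) (cong x₃ e))
    where
    flip : ∀ a a′ b b′ c c′ → (b + - a) * (c′ + - a′) + - ((b′ + - a′) * (c + - a)) ≡ 0# →
           (a + - b) * (c′ + - b′) + - ((a′ + - b′) * (c + - b)) ≡ 0#
    flip a a′ b b′ c c′ e = trans
      (solve 6 (λ a a′ b b′ c c′ →
        (a :+ :- b) :* (c′ :+ :- b′) :+ :- ((a′ :+ :- b′) :* (c :+ :- b)) :=
        :- ((b :+ :- a) :* (c′ :+ :- a′) :+ :- ((b′ :+ :- a′) :* (c :+ :- a)))) refl a a′ b b′ c c′)
      (-‿0 e)

  collinear-line : ∀ x u r s t → Collinear (x ⊕ (r · u)) (x ⊕ (s · u)) (x ⊕ (t · u))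
  collinear-line x u r s t = pt-≡
    (vanish (x₂ x) (x₂ u) (x₃ x) (x₃ u)) (vanish (x₃ x) (x₃ u) (x₁ x) (x₁ u)) (vanish (x₁ x) (x₁ u) (x₂ x) (x₂ u))
    where
    vanish : ∀ x u x′ u′ →
      (x + s * u + - (x + r * u)) * (x′ + t * u′ + - (x′ + r * u′)) +
      - ((x′ + s * u′ + - (x′ + r * u′)) * (x + t * u + - (x + r * u))) ≡ 0#
    vanish x u x′ u′ = solve 7 (λ x u x′ u′ r s t →
      (x :+ s :* u :+ :- (x :+ r :* u)) :* (x′ :+ t :* u′ :+ :- (x′ :+ r :* u′)) :+
      :- ((x′ :+ s :* u′ :+ :- (x′ :+ r :* u′)) :* (x :+ t :* u :+ :- (x :+ r :* u))) := con (ℤ.+ 0))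
      refl x u x′ u′ r s t

  collinear⇒onLine : ∀ {a b c} → a ≢ b → Collinear a b c → ∃ λ s → c ≡ a ⊕ (s · (b ⊖ a))
  collinear⇒onLine {a} {b} {c} a≢b abc =
    let s , e = cross≡𝟎⇒multiple (λ e → a≢b (⊖≡𝟎⇒≡ e)) abc
    in s , trans (⊕-⊖ a c) (cong (a ⊕_) e)

  onLine⇒collinear : ∀ {x u c d e r s t} → c ≡ x ⊕ (r · u) → d ≡ x ⊕ (s · u) → e ≡ x ⊕ (t · u) → Collinear c d e
  onLine⇒collinear {x} {u} {r = r} {s} {t} refl refl refl = collinear-line x u r s t

  -- All three points are parametrised along b ⊖ a from a. Collinearities in the counting are
  -- derived from this together with permutations and repeated points.
  collinear-onLine : ∀ {a b c d e} → a ≢ b → Collinear a b c → Collinear a b d → Collinear a b e →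
                     Collinear c d e
  collinear-onLine a≢b abc abd abe =
    onLine⇒collinear (proj₂ (collinear⇒onLine a≢b abc)) (proj₂ (collinear⇒onLine a≢b abd))
      (proj₂ (collinear⇒onLine a≢b abe))

  collinear-repeat : ∀ a b → Collinear a b b
  collinear-repeat a b = pt-≡ (vanish _ _) (vanish _ _) (vanish _ _)
    where
    vanish : ∀ u w → u * w + - (w * u) ≡ 0#
    vanish u w = x≡y⇒x-y≡0 (*-comm u w)

  -- Coplanarity of four points as a determinant condition.

  det₄ : Pt → Pt → Pt → Pt → Carrier
  det₄ a b c d = det (b ⊖ a) (c ⊖ a) (d ⊖ a)

  det-swap₁₂ : ∀ u w v → det w u v ≡ - det u w v
  det-swap₁₂ u w v = solve 9 (λ u₁ u₂ u₃ w₁ w₂ w₃ v₁ v₂ v₃ →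
    (w₂ :* u₃ :+ :- (w₃ :* u₂)) :* v₁ :+ (w₃ :* u₁ :+ :- (w₁ :* u₃)) :* v₂ :+ (w₁ :* u₂ :+ :- (w₂ :* u₁)) :* v₃ :=
    :- ((u₂ :* w₃ :+ :- (u₃ :* w₂)) :* v₁ :+ (u₃ :* w₁ :+ :- (u₁ :* w₃)) :* v₂ :+ (u₁ :* w₂ :+ :- (u₂ :* w₁)) :* v₃))
    refl (x₁ u) (x₂ u) (x₃ u) (x₁ w) (x₂ w) (x₃ w) (x₁ v) (x₂ v) (x₃ v)

  det-swap₂₃ : ∀ u w v → det u v w ≡ - det u w v
  det-swap₂₃ u w v = solve 9 (λ u₁ u₂ u₃ w₁ w₂ w₃ v₁ v₂ v₃ →
    (u₂ :* v₃ :+ :- (u₃ :* v₂)) :* w₁ :+ (u₃ :* v₁ :+ :- (u₁ :* v₃)) :* w₂ :+ (u₁ :* v₂ :+ :- (u₂ :* v₁)) :* w₃ :=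
    :- ((u₂ :* w₃ :+ :- (u₃ :* w₂)) :* v₁ :+ (u₃ :* w₁ :+ :- (u₁ :* w₃)) :* v₂ :+ (u₁ :* w₂ :+ :- (u₂ :* w₁)) :* v₃))
    refl (x₁ u) (x₂ u) (x₃ u) (x₁ w) (x₂ w) (x₃ w) (x₁ v) (x₂ v) (x₃ v)

  -- This swap moves the base point of the difference vectors, so it is an identity in all twelve
  -- coordinates and not an antisymmetry of `det`.
  det₄-swap₁₂ : ∀ a b c d → det₄ b a c d ≡ - det₄ a b c d
  det₄-swap₁₂ a b c d = solve 12 (λ a₁ a₂ a₃ b₁ b₂ b₃ c₁ c₂ c₃ d₁ d₂ d₃ →
    det₄ᵖ b₁ b₂ b₃ a₁ a₂ a₃ c₁ c₂ c₃ d₁ d₂ d₃ := :- det₄ᵖ a₁ a₂ a₃ b₁ b₂ b₃ c₁ c₂ c₃ d₁ d₂ d₃)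
    refl (x₁ a) (x₂ a) (x₃ a) (x₁ b) (x₂ b) (x₃ b) (x₁ c) (x₂ c) (x₃ c) (x₁ d) (x₂ d) (x₃ d)
    where
    minor : ∀ {n} → (a b c a′ b′ c′ : Polynomial n) → Polynomial n
    minor a b c a′ b′ c′ = (b :+ :- a) :* (c′ :+ :- a′) :+ :- ((b′ :+ :- a′) :* (c :+ :- a))
    det₄ᵖ : ∀ {n} → (a₁ a₂ a₃ b₁ b₂ b₃ c₁ c₂ c₃ d₁ d₂ d₃ : Polynomial n) → Polynomial n
    det₄ᵖ a₁ a₂ a₃ b₁ b₂ b₃ c₁ c₂ c₃ d₁ d₂ d₃ =
      minor a₂ b₂ c₂ a₃ b₃ c₃ :* (d₁ :+ :- a₁) :+
      minor a₃ b₃ c₃ a₁ b₁ c₁ :* (d₂ :+ :- a₂) :+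
      minor a₁ b₁ c₁ a₂ b₂ c₂ :* (d₃ :+ :- a₃)

  -- A single polynomial equation is decidable and invariant under permutations, which an
  -- existential plane would not show directly.
  AffDep₄ : Pt → Pt → Pt → Pt → Set
  AffDep₄ a b c d = det₄ a b c d ≡ 0#

  affDep₄? : ∀ a b c d → Dec (AffDep₄ a b c d)
  affDep₄? a b c d = det₄ a b c d ≟ 0#

  affDep₄-swap₁₂ : ∀ a b c d → AffDep₄ a b c d → AffDep₄ b a c d
  affDep₄-swap₁₂ a b c d e = trans (det₄-swap₁₂ a b c d) (-‿0 e)

  affDep₄-swap₂₃ : ∀ a b c d → AffDep₄ a b c d → AffDep₄ a c b d
  affDep₄-swap₂₃ a b c d e = trans (det-swap₁₂ (b ⊖ a) (c ⊖ a) (d ⊖ a)) (-‿0 e)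

  affDep₄-swap₃₄ : ∀ a b c d → AffDep₄ a b c d → AffDep₄ a b d c
  affDep₄-swap₃₄ a b c d e = trans (det-swap₂₃ (b ⊖ a) (c ⊖ a) (d ⊖ a)) (-‿0 e)

  collinear⇒affDep₄ : ∀ {a b c} d → Collinear a b c → AffDep₄ a b c d
  collinear⇒affDep₄ {a} {b} {c} d e =
    trans (cong (λ n → dot n (d ⊖ a)) e)
      (trans (x+0≡x (zeroˡ _)) (trans (x+0≡x (zeroˡ _)) (zeroˡ _)))

  det-·₁ : ∀ s u w v → det (s · u) w v ≡ s * det u w v
  det-·₁ s u w v = solve 10 (λ s u₁ u₂ u₃ w₁ w₂ w₃ v₁ v₂ v₃ →
    (s :* u₂ :* w₃ :+ :- (s :* u₃ :* w₂)) :* v₁ :+ (s :* u₃ :* w₁ :+ :- (s :* u₁ :* w₃)) :* v₂ :+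
      (s :* u₁ :* w₂ :+ :- (s :* u₂ :* w₁)) :* v₃ :=
    s :* ((u₂ :* w₃ :+ :- (u₃ :* w₂)) :* v₁ :+ (u₃ :* w₁ :+ :- (u₁ :* w₃)) :* v₂ :+ (u₁ :* w₂ :+ :- (u₂ :* w₁)) :* v₃))
    refl s (x₁ u) (x₂ u) (x₃ u) (x₁ w) (x₂ w) (x₃ w) (x₁ v) (x₂ v) (x₃ v)

  -- The points c, a, b, d are coplanar since b, d, a are collinear. Sliding a to a′ along the line
  -- ca multiplies the vector a ⊖ c, and with it the determinant, by a scalar.
  affDep₄-onLine : ∀ {a b c d a′} → a ≢ c → Collinear c a a′ → Collinear b d a → AffDep₄ a′ b c d
  affDep₄-onLine {a} {b} {c} {d} {a′} a≢c caa′ bda =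
    affDep₄-swap₂₃ a′ c b d (affDep₄-swap₁₂ c a′ b d ca′bd)
    where
    cabd : AffDep₄ c a b d
    cabd = affDep₄-swap₁₂ a c b d (affDep₄-swap₂₃ a b c d (affDep₄-swap₃₄ a b d c
             (affDep₄-swap₁₂ b a d c (affDep₄-swap₂₃ b d a c (collinear⇒affDep₄ c bda)))))
    multiple : ∃ λ s → a′ ⊖ c ≡ s · (a ⊖ c)
    multiple = cross≡𝟎⇒multiple (λ e → a≢c (sym (⊖≡𝟎⇒≡ e))) caa′
    ca′bd : AffDep₄ c a′ b d
    ca′bd = trans (cong (λ u → det u (b ⊖ c) (d ⊖ c)) (proj₂ multiple))
              (trans (det-·₁ (proj₁ multiple) (a ⊖ c) (b ⊖ c) (d ⊖ c)) (*-zeroʳ cabd))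

  -- The q + 1 planes through a line.

  -- The point (f : g) of the projective line, with `zero` for infinite slope. The pair (0, 0) also
  -- goes to `zero`, which is harmless because proportionality still holds there.
  slopeIndex : Carrier → Carrier → Fin (suc size)
  slopeIndex f g with f ≟ 0#
  ... | yes _  = zero
  ... | no f≢0 = suc (elementIndex (g * proj₁ (inverse f f≢0)))

  slopeIndex-proportional : ∀ f g f′ g′ → slopeIndex f g ≡ slopeIndex f′ g′ → f * g′ ≡ g * f′
  slopeIndex-proportional f g f′ g′ eq with f ≟ 0# | f′ ≟ 0#
  ... | yes f≡0 | yes f′≡0 = trans (*-zeroˡ f≡0) (sym (*-zeroʳ f′≡0))
  ... | no f≢0  | no f′≢0  with i , fi≡1 ← inverse f f≢0 | i′ , f′i′≡1 ← inverse f′ f′≢0 = begin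
    f * g′              ≡⟨ *-identityʳ _ ⟨
    f * g′ * 1#         ≡⟨ cong (f * g′ *_) f′i′≡1 ⟨
    f * g′ * (f′ * i′)  ≡⟨ solve 4 (λ f g′ f′ i′ → f :* g′ :* (f′ :* i′) := f :* f′ :* (g′ :* i′)) refl f g′ f′ i′ ⟩
    f * f′ * (g′ * i′)  ≡⟨ cong (f * f′ *_) (elementIndex-injective (suc-injective eq)) ⟨
    f * f′ * (g * i)    ≡⟨ solve 4 (λ f f′ g i → f :* f′ :* (g :* i) := g :* f′ :* (f :* i)) refl f f′ g i ⟩
    g * f′ * (f * i)    ≡⟨ cong (g * f′ *_) fi≡1 ⟩
    g * f′ * 1#         ≡⟨ *-identityʳ _ ⟩
    g * f′              ∎
    where open ≡-Reasoning

  -- The planes through a line of direction u correspond to the slopes in the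
  -- projection along u to a coordinate plane.
  pencilIndex : ∀ {u} → NonzeroCoordinate u → Pt → Fin (suc size)
  pencilIndex {pt u₁ u₂ u₃} (first  _) (pt w₁ w₂ w₃) = slopeIndex (u₁ * w₂ + - (u₂ * w₁)) (u₁ * w₃ + - (u₃ * w₁))
  pencilIndex {pt u₁ u₂ u₃} (second _) (pt w₁ w₂ w₃) = slopeIndex (u₂ * w₃ + - (u₃ * w₂)) (u₂ * w₁ + - (u₁ * w₂))
  pencilIndex {pt u₁ u₂ u₃} (third  _) (pt w₁ w₂ w₃) = slopeIndex (u₃ * w₁ + - (u₁ * w₃)) (u₃ * w₂ + - (u₂ * w₃))

  -- Chio's pivotal condensation with pivot u₁: equal slopes of the projections along u mean that
  -- the right-hand side vanishes.
  condensation : ∀ u₁ u₂ u₃ w₁ w₂ w₃ v₁ v₂ v₃ →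
    u₁ * ((u₂ * w₃ + - (u₃ * w₂)) * v₁ + (u₃ * w₁ + - (u₁ * w₃)) * v₂ + (u₁ * w₂ + - (u₂ * w₁)) * v₃) ≡
    (u₁ * w₂ + - (u₂ * w₁)) * (u₁ * v₃ + - (u₃ * v₁)) + - ((u₁ * w₃ + - (u₃ * w₁)) * (u₁ * v₂ + - (u₂ * v₁)))
  condensation = solve 9 (λ u₁ u₂ u₃ w₁ w₂ w₃ v₁ v₂ v₃ →
    u₁ :* ((u₂ :* w₃ :+ :- (u₃ :* w₂)) :* v₁ :+ (u₃ :* w₁ :+ :- (u₁ :* w₃)) :* v₂ :+
      (u₁ :* w₂ :+ :- (u₂ :* w₁)) :* v₃) :=
    (u₁ :* w₂ :+ :- (u₂ :* w₁)) :* (u₁ :* v₃ :+ :- (u₃ :* v₁)) :+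
      :- ((u₁ :* w₃ :+ :- (u₃ :* w₁)) :* (u₁ :* v₂ :+ :- (u₂ :* v₁)))) refl

  proportional⇒det≡0 : ∀ u₁ u₂ u₃ w₁ w₂ w₃ v₁ v₂ v₃ → u₁ ≢ 0# →
    (u₁ * w₂ + - (u₂ * w₁)) * (u₁ * v₃ + - (u₃ * v₁)) ≡ (u₁ * w₃ + - (u₃ * w₁)) * (u₁ * v₂ + - (u₂ * v₁)) →
    (u₂ * w₃ + - (u₃ * w₂)) * v₁ + (u₃ * w₁ + - (u₁ * w₃)) * v₂ + (u₁ * w₂ + - (u₂ * w₁)) * v₃ ≡ 0#
  proportional⇒det≡0 u₁ u₂ u₃ w₁ w₂ w₃ v₁ v₂ v₃ ≢0 e =
    *-cancelˡ-0 ≢0 (trans (condensation u₁ u₂ u₃ w₁ w₂ w₃ v₁ v₂ v₃) (x≡y⇒x-y≡0 e))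

  pencilIndex-det : ∀ {u} (nz : NonzeroCoordinate u) w v → pencilIndex nz w ≡ pencilIndex nz v → det u w v ≡ 0#
  pencilIndex-det {pt u₁ u₂ u₃} (first ≢0) (pt w₁ w₂ w₃) (pt v₁ v₂ v₃) eq =
    proportional⇒det≡0 u₁ u₂ u₃ w₁ w₂ w₃ v₁ v₂ v₃ ≢0 (slopeIndex-proportional _ _ _ _ eq)
  pencilIndex-det {pt u₁ u₂ u₃} (second ≢0) (pt w₁ w₂ w₃) (pt v₁ v₂ v₃) eq =
    trans (+-rotate _ _ _)
      (proportional⇒det≡0 u₂ u₃ u₁ w₂ w₃ w₁ v₂ v₃ v₁ ≢0 (slopeIndex-proportional _ _ _ _ eq))
  pencilIndex-det {pt u₁ u₂ u₃} (third ≢0) (pt w₁ w₂ w₃) (pt v₁ v₂ v₃) eq =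
    trans (sym (+-rotate _ _ _))
      (proportional⇒det≡0 u₃ u₁ u₂ w₃ w₁ w₂ v₃ v₁ v₂ ≢0 (slopeIndex-proportional _ _ _ _ eq))

  -- The value at a = b is a default; conclusions are drawn from the index only for a ≠ b.
  planeIndex : Pt → Pt → Pt → Fin (suc size)
  planeIndex a b c with a ≟ₚ b
  ... | yes _  = zero
  ... | no a≢b = pencilIndex (nonzeroCoordinate (b ⊖ a) (λ e → a≢b (⊖≡𝟎⇒≡ e))) (c ⊖ a)

  planeIndex-affDep₄ : ∀ a b c d → a ≢ b → planeIndex a b c ≡ planeIndex a b d → AffDep₄ a b c d
  planeIndex-affDep₄ a b c d a≢b eq with a ≟ₚ b
  ... | yes a≡b = contradiction a≡b a≢b
  ... | no a≢b′ = pencilIndex-det (nonzeroCoordinate (b ⊖ a) (λ e → a≢b′ (⊖≡𝟎⇒≡ e))) (c ⊖ a) (d ⊖ a) eq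

  -- The at most q points on a line.

  pivot : ∀ {u} → NonzeroCoordinate u → Pt → Carrier
  pivot (first  _) = x₁
  pivot (second _) = x₂
  pivot (third  _) = x₃

  affine-injective : ∀ {a u s t} → u ≢ 0# → a + s * u ≡ a + t * u → s ≡ t
  affine-injective {a} {u} {s} {t} u≢0 e = x-y≡0⇒x≡y (*-cancelˡ-0 u≢0 (trans
    (solve 4 (λ a s t u → u :* (s :+ :- t) := a :+ s :* u :+ :- (a :+ t :* u)) refl a s t u)
    (x≡y⇒x-y≡0 e)))

  pivot-injective : ∀ {a u s t} (nz : NonzeroCoordinate u) →
                    pivot nz (a ⊕ (s · u)) ≡ pivot nz (a ⊕ (t · u)) → s ≡ t
  pivot-injective (first  ≢0) = affine-injective ≢0
  pivot-injective (second ≢0) = affine-injective ≢0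
  pivot-injective (third  ≢0) = affine-injective ≢0

  -- A coordinate in which b ⊖ a is nonzero is injective along the line ab. The value at a = b is
  -- again a default.
  lineIndex : Pt → Pt → Pt → Fin size
  lineIndex a b c with a ≟ₚ b
  ... | yes _  = elementIndex 0#
  ... | no a≢b = elementIndex (pivot (nonzeroCoordinate (b ⊖ a) (λ e → a≢b (⊖≡𝟎⇒≡ e))) c)

  lineIndex-injective : ∀ {a b c d} → a ≢ b → Collinear a b c → Collinear a b d →
                        lineIndex a b c ≡ lineIndex a b d → c ≡ d
  lineIndex-injective {a} {b} {c} {d} a≢b abc abd eq with a ≟ₚ b
  ... | yes a≡b = contradiction a≡b a≢b
  ... | no a≢b′ = onLine-≡ (collinear⇒onLine a≢b abc) (collinear⇒onLine a≢b abd) (elementIndex-injective eq)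
    where
    nz = nonzeroCoordinate (b ⊖ a) (λ e → a≢b′ (⊖≡𝟎⇒≡ e))
    onLine-≡ : ∀ {c d} → (∃ λ s → c ≡ a ⊕ (s · (b ⊖ a))) → (∃ λ t → d ≡ a ⊕ (t · (b ⊖ a))) →
               pivot nz c ≡ pivot nz d → c ≡ d
    onLine-≡ (s , refl) (t , refl) e = cong (λ r → a ⊕ (r · (b ⊖ a))) (pivot-injective {a} nz e)

  -- From determinant conditions to planes and critical quadruples.

  collinear-repeat₁₂ : ∀ a b → Collinear a a b
  collinear-repeat₁₂ a b = collinear-swap₂₃ {a} {b} {a} (collinear-swap₁₂ {b} {a} {a} (collinear-repeat b a))

  ¬collinear⇒≢₁₂ : ∀ {a b c} → ¬ Collinear a b c → a ≢ b
  ¬collinear⇒≢₁₂ {a} {c = c} ¬abc refl = ¬abc (collinear-repeat₁₂ a c)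

  ¬collinear⇒≢₁₃ : ∀ {a b c} → ¬ Collinear a b c → a ≢ c
  ¬collinear⇒≢₁₃ {a} {b} ¬abc refl = ¬abc (collinear-swap₂₃ {a} {a} {b} (collinear-repeat₁₂ a b))

  ¬collinear⇒≢₂₃ : ∀ {a b c} → ¬ Collinear a b c → b ≢ c
  ¬collinear⇒≢₂₃ {a} {b} ¬abc refl = ¬abc (collinear-repeat a b)

  affDep₄⇒coplanar : ∀ {a b c d} → ¬ Collinear a b c → AffDep₄ a b c d → Coplanar a b c d
  affDep₄⇒coplanar {a} {b} {c} {d} ¬abc e =
    plane a (b ⊖ a) (c ⊖ a) (linIndep₂ ¬abc) ,
    (0# , 0# , pt-≡ (at-a _ _ _) (at-a _ _ _) (at-a _ _ _)) ,
    (1# , 0# , pt-≡ (at-b _ _ _) (at-b _ _ _) (at-b _ _ _)) ,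
    (0# , 1# , pt-≡ (at-c _ _ _) (at-c _ _ _) (at-c _ _ _)) ,
    at-d (det≡0⇒combination ¬abc e)
    where
    at-a : ∀ a u w → a ≡ a + 0# * u + 0# * w
    at-a = solve 3 (λ a u w → a := a :+ con (ℤ.+ 0) :* u :+ con (ℤ.+ 0) :* w) refl
    at-b : ∀ a b w → b ≡ a + 1# * (b + - a) + 0# * w
    at-b a b w = begin
      b                                ≡⟨ solve 3 (λ a b w → b := a :+ (b :+ :- a) :+ con (ℤ.+ 0) :* w) refl a b w ⟩
      -- In the solver `con (ℤ.+ 1)` would denote `1# + 0#`, so the factor `1#` is removed by hand.
      a + (b + - a) + 0# * w           ≡⟨ cong (λ x → a + x + 0# * w) (*-identityˡ _) ⟨
      a + 1# * (b + - a) + 0# * w      ∎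
      where open ≡-Reasoning
    at-c : ∀ a u c → c ≡ a + 0# * u + 1# * (c + - a)
    at-c a u c = begin
      c                                ≡⟨ solve 3 (λ a u c → c := a :+ con (ℤ.+ 0) :* u :+ (c :+ :- a)) refl a u c ⟩
      a + 0# * u + (c + - a)           ≡⟨ cong (a + 0# * u +_) (*-identityˡ _) ⟨
      a + 0# * u + 1# * (c + - a)      ∎
      where open ≡-Reasoning
    assoc : ∀ a s u t w d → d + - a ≡ s * u + t * w → d ≡ a + s * u + t * w
    assoc a s u t w d e = begin
      d                      ≡⟨ solve 2 (λ a d → d := a :+ (d :+ :- a)) refl a d ⟩
      a + (d + - a)          ≡⟨ cong (a +_) e ⟩
      a + (s * u + t * w)    ≡⟨ +-assoc _ _ _ ⟨
      a + s * u + t * w      ∎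
      where open ≡-Reasoning
    at-d : (∃ λ s → ∃ λ t → d ⊖ a ≡ (s · (b ⊖ a)) ⊕ (t · (c ⊖ a))) →
           ∃ λ s → ∃ λ t → d ≡ (a ⊕ (s · (b ⊖ a))) ⊕ (t · (c ⊖ a))
    at-d (s , t , e) = s , t ,
      pt-≡ (assoc _ _ _ _ _ _ (cong x₁ e)) (assoc _ _ _ _ _ _ (cong x₂ e)) (assoc _ _ _ _ _ _ (cong x₃ e))

  affIndep₂ : ∀ {a b} → a ≢ b → AffIndep₂ a b
  affIndep₂ a≢b _ = ·-cancelʳ-𝟎 (λ e → a≢b (⊖≡𝟎⇒≡ e))

  -- Every pair lies in one of the four triples, whose non-collinearity already makes its points
  -- distinct.
  critical : ∀ {a b c d} → ¬ Collinear a b c → ¬ Collinear a b d → ¬ Collinear a c d → ¬ Collinear b c d →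
             Critical a b c d
  critical {a} {b} {c} {d} ¬abc ¬abd ¬acd ¬bcd =
    affIndep₂ (¬collinear⇒≢₁₂ ¬abc) , affIndep₂ (¬collinear⇒≢₁₃ ¬abc) , affIndep₂ (¬collinear⇒≢₁₃ ¬abd) ,
    affIndep₂ (¬collinear⇒≢₂₃ ¬abc) , affIndep₂ (¬collinear⇒≢₂₃ ¬abd) , affIndep₂ (¬collinear⇒≢₂₃ ¬acd) ,
    linIndep₂ ¬abc , linIndep₂ ¬abd , linIndep₂ ¬acd , linIndep₂ ¬bcd

-- Sums of indicators and a Cauchy-Schwarz estimate.

module QuadrupleCounting where

  open import Data.Nat using (_+_; _*_; _≤_; z≤n; s≤s; _^_)
  open import Data.Nat.Properties using
    ( ≤-refl; ≤-trans; ≤-total; ≤-antisym; +-mono-≤; +-monoˡ-≤; +-monoʳ-≤; *-monoʳ-≤; *-monoˡ-≤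
    ; +-*-semiring; *-zeroʳ; *-comm; *-identityʳ; m≤m+n; m≤n⇒m≤o+n; m≤n⇒m≤n+o
    ; m≤n⇒∃[o]m+o≡n; +-cancelʳ-≤; *-cancelˡ-≤; module ≤-Reasoning )
  open import Data.Nat.Solver using (module +-*-Solver)
  open import Algebra.Properties.Semiring.Sum +-*-semiring using
    (sum; sum-syntax; ∑-comm; ∑-distrib-+; sum-cong-≗; *-distribˡ-sum; *-distribʳ-sum)
  open import Data.Fin using (_<_)
  open import Data.Fin.Properties using (_<?_; <-cmp)

  χ : ∀ {P : Set} → Dec P → ℕ
  χ d = if does d then 1 else 0

  χ-≤ : ∀ {P : Set} (d : Dec P) {k} → (P → 1 ≤ k) → χ d ≤ k
  χ-≤ (yes p) 1≤k = 1≤k p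
  χ-≤ (no _)  _   = z≤n

  1≤χ : ∀ {P : Set} (d : Dec P) → P → 1 ≤ χ d
  1≤χ (yes _) _ = ≤-refl
  1≤χ (no ¬p) p = contradiction p ¬p

  χ-× : ∀ {P Q : Set} (d : Dec P) (e : Dec Q) → χ d * χ e ≡ χ (d ×-dec e)
  χ-× (yes _) (yes _) = refl
  χ-× (yes _) (no _)  = refl
  χ-× (no _)  _       = refl

  χ-¬ : ∀ {P : Set} (d : Dec P) → χ (¬? d) + χ d ≡ 1
  χ-¬ (yes _) = refl
  χ-¬ (no _)  = refl

  sum-mono-≤ : ∀ {n} {f g : Fin n → ℕ} → (∀ i → f i ≤ g i) → sum f ≤ sum g
  sum-mono-≤ {zero}  f≤g = z≤n
  sum-mono-≤ {suc n} f≤g = +-mono-≤ (f≤g zero) (sum-mono-≤ (f≤g ∘ suc))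

  sum-const : ∀ n c → ∑[ i < n ] c ≡ n * c
  sum-const zero    c = refl
  sum-const (suc n) c = cong (c +_) (sum-const n c)

  term≤sum : ∀ {n} (f : Fin n → ℕ) i → f i ≤ sum f
  term≤sum f zero    = m≤m+n _ _
  term≤sum f (suc i) = m≤n⇒m≤o+n (f zero) (term≤sum (f ∘ suc) i)

  -- The bound is k instead of 1 so that k may itself be an indicator implied by P; a fibre with at
  -- most one element is then bounded by whether its target qualifies.
  sum-χ-unique : ∀ {n} {P : Fin n → Set} (d : ∀ i → Dec (P i)) {k} →
                 (∀ i j → P i → P j → i ≡ j) → (∀ i → P i → 1 ≤ k) → ∑[ i < n ] χ (d i) ≤ k
  sum-χ-unique {zero}  d unique 1≤k = z≤n
  sum-χ-unique {suc n} {P} d {k} unique 1≤k with d zero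
  ... | no _  = sum-χ-unique (d ∘ suc) (λ i j pi pj → suc-injective (unique _ _ pi pj)) (1≤k ∘ suc)
  ... | yes p = begin
    1 + ∑[ i < n ] χ (d (suc i))  ≤⟨ s≤s (sum-mono-≤ λ i → χ-≤ (d (suc i)) λ p′ → contradiction (unique _ _ p p′) 0≢1+n) ⟩
    1 + ∑[ i < n ] 0              ≡⟨ cong suc (trans (sum-const n 0) (*-zeroʳ n)) ⟩
    1                             ≤⟨ 1≤k zero p ⟩
    k                             ∎
    where open ≤-Reasoning

  sum-χ-injection : ∀ {n q} {P : Fin n → Set} (d : ∀ i → Dec (P i)) (φ : Fin n → Fin q) →
                    (∀ i j → P i → P j → φ i ≡ φ j → i ≡ j) → ∑[ i < n ] χ (d i) ≤ q
  sum-χ-injection {n} {q} d φ injective = begin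
    ∑[ i < n ] χ (d i)
      ≤⟨ sum-mono-≤ (λ i → χ-≤ (d i) λ p → ≤-trans (1≤χ (d i ×-dec φ i ≟ᶠ φ i) (p , refl)) (term≤sum _ (φ i))) ⟩
    ∑[ i < n ] ∑[ k < q ] χ (d i ×-dec φ i ≟ᶠ k)
      ≡⟨ ∑-comm (λ i k → χ (d i ×-dec φ i ≟ᶠ k)) ⟩
    ∑[ k < q ] ∑[ i < n ] χ (d i ×-dec φ i ≟ᶠ k)
      ≤⟨ sum-mono-≤ (λ k → sum-χ-unique (λ i → d i ×-dec φ i ≟ᶠ k)
           (λ i j (p , e) (p′ , e′) → injective i j p p′ (trans e (sym e′))) (λ _ _ → ≤-refl)) ⟩
    ∑[ k < q ] 1
      ≡⟨ trans (sum-const q 1) (*-identityʳ q) ⟩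
    q ∎
    where open ≤-Reasoning

  2xy≤x²+y² : ∀ x y → 2 * (x * y) ≤ x * x + y * y
  2xy≤x²+y² x y with ≤-total x y
  ... | inj₁ x≤y with k , refl ← m≤n⇒∃[o]m+o≡n x≤y = begin
    2 * (x * (x + k))          ≤⟨ m≤m+n _ (k * k) ⟩
    2 * (x * (x + k)) + k * k  ≡⟨ solve 2 (λ x k → con 2 :* (x :* (x :+ k)) :+ k :* k :=
                                    x :* x :+ (x :+ k) :* (x :+ k)) refl x k ⟩
    x * x + (x + k) * (x + k)  ∎
    where open ≤-Reasoning
          open +-*-Solver
  ... | inj₂ y≤x with k , refl ← m≤n⇒∃[o]m+o≡n y≤x = begin
    2 * ((y + k) * y)          ≤⟨ m≤m+n _ (k * k) ⟩
    2 * ((y + k) * y) + k * k  ≡⟨ solve 2 (λ y k → con 2 :* ((y :+ k) :* y) :+ k :* k :=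
                                    (y :+ k) :* (y :+ k) :+ y :* y) refl y k ⟩
    (y + k) * (y + k) + y * y  ∎
    where open ≤-Reasoning
          open +-*-Solver

  -- The Cauchy–Schwarz inequality for class sizes, linearised by 2xy ≤ x² + y²
  -- so that the average class size need not be an integer.
  pairs-in-classes : ∀ {n m} {P : Fin n → Set} (d : ∀ i → Dec (P i)) (φ : Fin n → Fin m) κ μ →
    2 * (κ * μ) * ∑[ i < n ] χ (d i) ≤
    κ * κ * ∑[ i < n ] ∑[ j < n ] χ (d i ×-dec d j ×-dec φ i ≟ᶠ φ j) + m * (μ * μ)
  pairs-in-classes {n} {m} d φ κ μ = begin
    2 * (κ * μ) * ∑[ i < n ] χ (d i)
      ≤⟨ *-monoʳ-≤ (2 * (κ * μ)) (sum-mono-≤ λ i → χ-≤ (d i) λ p →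
           ≤-trans (1≤χ (e i (φ i)) (p , refl)) (term≤sum _ (φ i))) ⟩
    2 * (κ * μ) * ∑[ i < n ] ∑[ k < m ] χ (e i k)
      ≡⟨ cong (2 * (κ * μ) *_) (∑-comm (λ i k → χ (e i k))) ⟩
    2 * (κ * μ) * ∑[ k < m ] h k
      ≡⟨ *-distribˡ-sum (2 * (κ * μ)) h ⟩
    ∑[ k < m ] (2 * (κ * μ) * h k)
      ≤⟨ sum-mono-≤ (λ k → term (h k)) ⟩
    ∑[ k < m ] (κ * κ * (h k * h k) + μ * μ)
      ≡⟨ ∑-distrib-+ (λ k → κ * κ * (h k * h k)) (λ _ → μ * μ) ⟩
    ∑[ k < m ] (κ * κ * (h k * h k)) + ∑[ k < m ] (μ * μ)
      ≡⟨ cong₂ _+_ (sym (*-distribˡ-sum (κ * κ) (λ k → h k * h k))) (sum-const m (μ * μ)) ⟩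
    κ * κ * ∑[ k < m ] (h k * h k) + m * (μ * μ)
      ≤⟨ +-monoˡ-≤ (m * (μ * μ)) (*-monoʳ-≤ (κ * κ) squares) ⟩
    κ * κ * ∑[ i < n ] ∑[ j < n ] χ (d i ×-dec d j ×-dec φ i ≟ᶠ φ j) + m * (μ * μ) ∎
    where
    open ≤-Reasoning
    e = λ i k → d i ×-dec φ i ≟ᶠ k
    h = λ k → ∑[ i < n ] χ (e i k)
    term : ∀ x → 2 * (κ * μ) * x ≤ κ * κ * (x * x) + μ * μ
    term x = begin
      2 * (κ * μ) * x            ≡⟨ solve 3 (λ κ μ x → con 2 :* (κ :* μ) :* x := con 2 :* (κ :* x :* μ)) refl κ μ x ⟩
      2 * (κ * x * μ)            ≤⟨ 2xy≤x²+y² (κ * x) μ ⟩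
      κ * x * (κ * x) + μ * μ    ≡⟨ solve 3 (λ κ μ x → κ :* x :* (κ :* x) :+ μ :* μ := κ :* κ :* (x :* x) :+ μ :* μ) refl κ μ x ⟩
      κ * κ * (x * x) + μ * μ    ∎
      where open +-*-Solver
    expand : ∀ k → h k * h k ≡ ∑[ i < n ] ∑[ j < n ] χ (e i k ×-dec e j k)
    expand k = trans (*-distribʳ-sum (h k) (λ i → χ (e i k)))
      (sum-cong-≗ λ i → trans (*-distribˡ-sum (χ (e i k)) (λ j → χ (e j k)))
        (sum-cong-≗ λ j → χ-× (e i k) (e j k)))
    squares : ∑[ k < m ] (h k * h k) ≤ ∑[ i < n ] ∑[ j < n ] χ (d i ×-dec d j ×-dec φ i ≟ᶠ φ j)
    squares = begin
      ∑[ k < m ] (h k * h k)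
        ≡⟨ sum-cong-≗ expand ⟩
      ∑[ k < m ] ∑[ i < n ] ∑[ j < n ] χ (e i k ×-dec e j k)
        ≡⟨ ∑-comm (λ k i → ∑[ j < n ] χ (e i k ×-dec e j k)) ⟩
      ∑[ i < n ] ∑[ k < m ] ∑[ j < n ] χ (e i k ×-dec e j k)
        ≡⟨ sum-cong-≗ (λ i → ∑-comm (λ k j → χ (e i k ×-dec e j k))) ⟩
      ∑[ i < n ] ∑[ j < n ] ∑[ k < m ] χ (e i k ×-dec e j k)
        ≤⟨ sum-mono-≤ (λ i → sum-mono-≤ λ j → sum-χ-unique (λ k → e i k ×-dec e j k)
             (λ _ _ ((_ , u) , _) ((_ , v) , _) → trans (sym u) v)
             (λ _ ((p , u) , (p′ , v)) → 1≤χ (d i ×-dec d j ×-dec φ i ≟ᶠ φ j) (p , p′ , trans u (sym v)))) ⟩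
      ∑[ i < n ] ∑[ j < n ] χ (d i ×-dec d j ×-dec φ i ≟ᶠ φ j) ∎

  -- Iterated sums and the renaming of their variables.

  module _ {n : ℕ} where

    ∑² : (Fin n → Fin n → ℕ) → ℕ
    ∑² f = ∑[ a < n ] ∑[ b < n ] f a b

    ∑³ : (Fin n → Fin n → Fin n → ℕ) → ℕ
    ∑³ f = ∑[ a < n ] ∑² (f a)

    ∑⁴ : (Fin n → Fin n → Fin n → Fin n → ℕ) → ℕ
    ∑⁴ f = ∑[ a < n ] ∑³ (f a)

    ∑²-mono-≤ : ∀ {f g} → (∀ a b → f a b ≤ g a b) → ∑² f ≤ ∑² g
    ∑²-mono-≤ f≤g = sum-mono-≤ λ a → sum-mono-≤ (f≤g a)

    ∑³-mono-≤ : ∀ {f g} → (∀ a b c → f a b c ≤ g a b c) → ∑³ f ≤ ∑³ g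
    ∑³-mono-≤ f≤g = sum-mono-≤ λ a → ∑²-mono-≤ (f≤g a)

    ∑⁴-mono-≤ : ∀ {f g} → (∀ a b c d → f a b c d ≤ g a b c d) → ∑⁴ f ≤ ∑⁴ g
    ∑⁴-mono-≤ f≤g = sum-mono-≤ λ a → ∑³-mono-≤ (f≤g a)

    ∑²-distrib-+ : ∀ f g → ∑² (λ a b → f a b + g a b) ≡ ∑² f + ∑² g
    ∑²-distrib-+ f g = trans (sum-cong-≗ λ a → ∑-distrib-+ (f a) (g a)) (∑-distrib-+ (λ a → sum (f a)) (λ a → sum (g a)))

    ∑³-distrib-+ : ∀ f g → ∑³ (λ a b c → f a b c + g a b c) ≡ ∑³ f + ∑³ g
    ∑³-distrib-+ f g = trans (sum-cong-≗ λ a → ∑²-distrib-+ (f a) (g a)) (∑-distrib-+ (λ a → ∑² (f a)) (λ a → ∑² (g a)))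

    ∑⁴-distrib-+ : ∀ f g → ∑⁴ (λ a b c d → f a b c d + g a b c d) ≡ ∑⁴ f + ∑⁴ g
    ∑⁴-distrib-+ f g = trans (sum-cong-≗ λ a → ∑³-distrib-+ (f a) (g a)) (∑-distrib-+ (λ a → ∑³ (f a)) (λ a → ∑³ (g a)))

    ∑³-swap₁₂ : ∀ f → ∑³ f ≡ ∑³ (λ a b c → f b a c)
    ∑³-swap₁₂ f = ∑-comm (λ a b → sum (f a b))

    ∑³-swap₂₃ : ∀ f → ∑³ f ≡ ∑³ (λ a b c → f a c b)
    ∑³-swap₂₃ f = sum-cong-≗ λ a → ∑-comm (f a)

    ∑⁴-swap₁₂ : ∀ f → ∑⁴ f ≡ ∑⁴ (λ a b c d → f b a c d)
    ∑⁴-swap₁₂ f = ∑-comm (λ a b → ∑² (f a b))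

    ∑⁴-swap₂₃ : ∀ f → ∑⁴ f ≡ ∑⁴ (λ a b c d → f a c b d)
    ∑⁴-swap₂₃ f = sum-cong-≗ λ a → ∑³-swap₁₂ (f a)

    ∑⁴-swap₃₄ : ∀ f → ∑⁴ f ≡ ∑⁴ (λ a b c d → f a b d c)
    ∑⁴-swap₃₄ f = sum-cong-≗ λ a → ∑³-swap₂₃ (f a)

  -- The incidence data on which the count rests.

  -- Stated on indices, so that distinct indices stand for distinct points. The three-dimensionality
  -- of the space enters through `planeIndex`, which takes only q + 1 values.
  record Configuration (n q : ℕ) : Set₁ where
    field
      Col  : Fin n → Fin n → Fin n → Set
      col? : ∀ a b c → Dec (Col a b c)
      Dep  : Fin n → Fin n → Fin n → Fin n → Set
      dep? : ∀ a b c d → Dec (Dep a b c d)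
      col-repeat : ∀ a b → Col a b b
      col-swap₁₂ : ∀ {a b c} → Col a b c → Col b a c
      col-swap₂₃ : ∀ {a b c} → Col a b c → Col a c b
      col-onLine : ∀ {a b c d e} → a ≢ b → Col a b c → Col a b d → Col a b e → Col c d e
      dep-swap₁₂ : ∀ {a b c d} → Dep a b c d → Dep b a c d
      dep-swap₂₃ : ∀ {a b c d} → Dep a b c d → Dep a c b d
      dep-swap₃₄ : ∀ {a b c d} → Dep a b c d → Dep a b d c
      dep-onLine : ∀ {a b c d a′} → a ≢ c → Col c a a′ → Col b d a → Dep a′ b c d
      lineIndex  : Fin n → Fin n → Fin n → Fin q
      lineIndex-injective : ∀ {a b c d} → a ≢ b → Col a b c → Col a b d →
                            lineIndex a b c ≡ lineIndex a b d → c ≡ d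
      planeIndex : Fin n → Fin n → Fin n → Fin (suc q)
      planeIndex-dep : ∀ {a b c d} → a ≢ b → planeIndex a b c ≡ planeIndex a b d → Dep a b c d

    -- Good: indices of a critical coplanar quadruple.
    Good : Fin n → Fin n → Fin n → Fin n → Set
    Good a b c d = Dep a b c d × ¬ Col a b c × ¬ Col a b d × ¬ Col a c d × ¬ Col b c d

    good? : ∀ a b c d → Dec (Good a b c d)
    good? a b c d = dep? a b c d ×-dec ¬? (col? a b c) ×-dec ¬? (col? a b d) ×-dec ¬? (col? a c d) ×-dec ¬? (col? b c d)

  -- Lower bound for ordered critical coplanar quadruples.

  module Counting {n q : ℕ} (C : Configuration n q) where
    open Configuration C

    Third : Fin n → Fin n → Fin n → Set
    Third a b e = e ≢ a × e ≢ b × Col a b e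

    third? : ∀ a b e → Dec (Third a b e)
    third? a b e = ¬? (e ≟ᶠ a) ×-dec ¬? (e ≟ᶠ b) ×-dec col? a b e

    Rich : Fin n → Fin n → Set
    Rich a b = ∃ (Third a b)

    rich? : ∀ a b → Dec (Rich a b)
    rich? a b = any? (third? a b)

    rich-sym : ∀ {a b} → Rich a b → Rich b a
    rich-sym (e , e≢a , e≢b , abe) = e , e≢b , e≢a , col-swap₁₂ abe

    -- The triangles a c b, with marked side a c, over whose marked side pairs
    -- of apices in a common plane are counted.
    Marked : Fin n → Fin n → Fin n → Set
    Marked a c b = ¬ Col a c b × (Rich a c ⊎ (¬ Rich a b × ¬ Rich c b))

    marked? : ∀ a c b → Dec (Marked a c b)
    marked? a c b = ¬? (col? a c b) ×-dec (rich? a c ⊎-dec (¬? (rich? a b) ×-dec ¬? (rich? c b)))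

    -- The failure with a on the line bd; the one with c on it is `Bad c b a d`. Since c is off that
    -- line, ac and bd meet only in a, so a can be moved off bd along ac and still be recovered.
    Bad : Fin n → Fin n → Fin n → Fin n → Set
    Bad a b c d = Rich a c × Col b d a × a ≢ b × a ≢ d × b ≢ d × ¬ Col b d c

    bad? : ∀ a b c d → Dec (Bad a b c d)
    bad? a b c d = rich? a c ×-dec col? b d a ×-dec ¬? (a ≟ᶠ b) ×-dec ¬? (a ≟ᶠ d) ×-dec ¬? (b ≟ᶠ d) ×-dec ¬? (col? b d c)

    col-repeat₁₂ : ∀ a b → Col a a b
    col-repeat₁₂ a b = col-swap₂₃ (col-swap₁₂ (col-repeat b a))

    col-repeat₁₃ : ∀ a b → Col a b a
    col-repeat₁₃ a b = col-swap₂₃ (col-repeat₁₂ a b)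

    #good #bad #marked #pairs : ℕ
    #good = ∑⁴ λ a b c d → χ (good? a b c d)
    #bad = ∑⁴ λ a b c d → χ (bad? a b c d)
    #marked = ∑³ λ a c b → χ (marked? a c b)
    #pairs = ∑⁴ λ a c b d → χ (marked? a c b ×-dec marked? a c d ×-dec planeIndex a c b ≟ᶠ planeIndex a c d)

    -- Distinct a, b admit at most q values of c. The n pairs with a = b admit n each, and their
    -- total n² turns q into q + 1.
    collinear-triples : ∑³ (λ a b c → χ (col? a b c)) ≤ n * (n * suc q)
    collinear-triples = begin
      ∑³ (λ a b c → χ (col? a b c))
        ≤⟨ ∑²-mono-≤ on-line ⟩
      ∑² {n} (λ a b → q + χ (a ≟ᶠ b) * n)
        ≤⟨ sum-mono-≤ row ⟩
      ∑[ a < n ] (n * suc q)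
        ≡⟨ sum-const n (n * suc q) ⟩
      n * (n * suc q) ∎
      where
      open ≤-Reasoning
      on-line : ∀ a b → ∑[ c < n ] χ (col? a b c) ≤ q + χ (a ≟ᶠ b) * n
      on-line a b with a ≟ᶠ b
      ... | no a≢b = m≤n⇒m≤n+o 0 (sum-χ-injection (col? a b) (lineIndex a b) (λ c d → lineIndex-injective a≢b))
      ... | yes _  = m≤n⇒m≤o+n q (begin
        ∑[ c < n ] χ (col? a b c)  ≤⟨ sum-mono-≤ (λ c → χ-≤ (col? a b c) λ _ → ≤-refl) ⟩
        ∑[ c < n ] 1               ≡⟨ trans (sum-const n 1) (*-comm n 1) ⟩
        1 * n                      ∎)
      row : ∀ a → ∑[ b < n ] (q + χ (a ≟ᶠ b) * n) ≤ n * suc q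
      row a = begin
        ∑[ b < n ] (q + χ (a ≟ᶠ b) * n)
          ≡⟨ ∑-distrib-+ (λ _ → q) (λ b → χ (a ≟ᶠ b) * n) ⟩
        ∑[ b < n ] q + ∑[ b < n ] (χ (a ≟ᶠ b) * n)
          ≡⟨ cong₂ _+_ (sum-const n q) (sym (*-distribʳ-sum n (λ b → χ (a ≟ᶠ b)))) ⟩
        n * q + ∑[ b < n ] χ (a ≟ᶠ b) * n
          ≤⟨ +-monoʳ-≤ (n * q) (*-monoˡ-≤ n (sum-χ-unique (a ≟ᶠ_) (λ _ _ u v → trans (sym u) v) (λ _ _ → ≤-refl))) ⟩
        n * q + 1 * n
          ≡⟨ solve 2 (λ n q → n :* q :+ con 1 :* n := n :* (con 1 :+ q)) refl n q ⟩
        n * suc q ∎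
        where open +-*-Solver

    marked-side : ∀ {a b c} → ¬ Col a b c → Marked a b c ⊎ Marked b c a ⊎ Marked a c b
    marked-side {a} {b} {c} ¬abc with rich? a b | rich? b c | rich? a c
    ... | yes ab | _      | _      = inj₁ (¬abc , inj₁ ab)
    ... | no _   | yes bc | _      = inj₂ (inj₁ (¬abc ∘ col-swap₁₂ ∘ col-swap₂₃ , inj₁ bc))
    ... | no _   | no _   | yes ac = inj₂ (inj₂ (¬abc ∘ col-swap₂₃ , inj₁ ac))
    -- Without a rich side all three sides are marked; any one of them serves.
    ... | no _   | no ¬bc | no ¬ac = inj₁ (¬abc , inj₂ (¬ac , ¬bc))

    χ-marked-side : ∀ a b c →
      χ (¬? (col? a b c)) ≤ χ (marked? a b c) + (χ (marked? b c a) + χ (marked? a c b))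
    χ-marked-side a b c = χ-≤ (¬? (col? a b c)) (side ∘ marked-side)
      where
      side : Marked a b c ⊎ Marked b c a ⊎ Marked a c b → 1 ≤ χ (marked? a b c) + (χ (marked? b c a) + χ (marked? a c b))
      side (inj₁ m)        = m≤n⇒m≤n+o _ (1≤χ (marked? a b c) m)
      side (inj₂ (inj₁ m)) = m≤n⇒m≤o+n (χ (marked? a b c)) (m≤n⇒m≤n+o _ (1≤χ (marked? b c a) m))
      side (inj₂ (inj₂ m)) = m≤n⇒m≤o+n (χ (marked? a b c)) (m≤n⇒m≤o+n (χ (marked? b c a)) (1≤χ (marked? a c b) m))

    -- The marked side has three possible positions in the triple, and each contributes `#marked`
    -- after renaming.
    noncollinear-triples : ∑³ (λ a b c → χ (¬? (col? a b c))) ≤ 3 * #marked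
    noncollinear-triples = begin
      ∑³ (λ a b c → χ (¬? (col? a b c)))
        ≤⟨ ∑³-mono-≤ χ-marked-side ⟩
      ∑³ (λ a b c → M a b c + (M b c a + M a c b))
        ≡⟨ ∑³-distrib-+ M (λ a b c → M b c a + M a c b) ⟩
      #marked + ∑³ (λ a b c → M b c a + M a c b)
        ≡⟨ cong (#marked +_) (∑³-distrib-+ (λ a b c → M b c a) (λ a b c → M a c b)) ⟩
      #marked + (∑³ (λ a b c → M b c a) + ∑³ (λ a b c → M a c b))
        ≡⟨ cong₂ (λ x y → #marked + (x + y))
             (trans (∑³-swap₁₂ (λ a b c → M b c a)) (sym (∑³-swap₂₃ M))) (sym (∑³-swap₂₃ M)) ⟩
      #marked + (#marked + #marked)
        ≡⟨ solve 1 (λ x → x :+ (x :+ x) := con 3 :* x) refl #marked ⟩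
      3 * #marked ∎
      where
      open ≤-Reasoning
      open +-*-Solver
      M = λ a b c → χ (marked? a b c)

    triples : n * (n * n) ≤ 3 * #marked + n * (n * suc q)
    triples = begin
      n * (n * n)
        ≡⟨ cong (λ x → n * (n * x)) (*-identityʳ n) ⟨
      n * (n * (n * 1))
        ≡⟨ sum³-const ⟨
      ∑³ {n} (λ a b c → 1)
        ≡⟨ sum-cong-≗ (λ a → sum-cong-≗ λ b → sum-cong-≗ λ c → χ-¬ (col? a b c)) ⟨
      ∑³ (λ a b c → χ (¬? (col? a b c)) + χ (col? a b c))
        ≡⟨ ∑³-distrib-+ (λ a b c → χ (¬? (col? a b c))) (λ a b c → χ (col? a b c)) ⟩
      ∑³ (λ a b c → χ (¬? (col? a b c))) + ∑³ (λ a b c → χ (col? a b c))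
        ≤⟨ +-mono-≤ noncollinear-triples collinear-triples ⟩
      3 * #marked + n * (n * suc q) ∎
      where
      open ≤-Reasoning
      sum³-const : ∑³ {n} (λ a b c → 1) ≡ n * (n * (n * 1))
      sum³-const = trans (sum-cong-≗ {n} λ a → trans (sum-cong-≗ {n} λ b → sum-const n 1) (sum-const n (n * 1))) (sum-const n (n * (n * 1)))

    bad-apex : ∀ {a b c d} → Marked a c b → Marked a c d → b ≢ d → Col a b d → Bad a b c d
    bad-apex {a} {b} {c} {d} (¬acb , m) (¬acd , _) b≢d abd =
      rich m , bda , a≢b , a≢d , b≢d , ¬bdc
      where
      a≢b : a ≢ b
      a≢b refl = ¬acb (col-repeat₁₃ a c)
      a≢d : a ≢ d
      a≢d refl = ¬acd (col-repeat₁₃ a c)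
      bda : Col b d a
      bda = col-swap₂₃ (col-swap₁₂ abd)
      ¬bdc : ¬ Col b d c
      ¬bdc bdc = ¬acb (col-onLine b≢d bda bdc (col-repeat₁₃ b d))
      rich : Rich a c ⊎ (¬ Rich a b × ¬ Rich c b) → Rich a c
      rich (inj₁ ac)        = ac
      -- The other apex d is a third point on the line ab, so ab is rich after all.
      rich (inj₂ (¬ab , _)) = contradiction (d , a≢d ∘ sym , b≢d ∘ sym , abd) ¬ab

    marked-swap : ∀ {a c b} → Marked a c b → Marked c a b
    marked-swap (¬acb , inj₁ ac)          = ¬acb ∘ col-swap₁₂ , inj₁ (rich-sym ac)
    marked-swap (¬acb , inj₂ (¬ab , ¬cb)) = ¬acb ∘ col-swap₁₂ , inj₂ (¬cb , ¬ab)

    -- The triples acb and acd are triangles by marking, so only abd and cbd can be collinear. The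
    -- two cases are exchanged by `marked-swap`.
    coplanar-apices : ∀ {a c b d} → Marked a c b → Marked a c d → planeIndex a c b ≡ planeIndex a c d →
                      b ≡ d ⊎ Good a b c d ⊎ Bad a b c d ⊎ Bad c b a d
    coplanar-apices {a} {c} {b} {d} m m′ eq with b ≟ᶠ d | col? a b d | col? c b d
    ... | yes b≡d | _       | _       = inj₁ b≡d
    ... | no b≢d  | yes abd | _       = inj₂ (inj₂ (inj₁ (bad-apex m m′ b≢d abd)))
    ... | no b≢d  | no _    | yes cbd = inj₂ (inj₂ (inj₂ (bad-apex (marked-swap m) (marked-swap m′) b≢d cbd)))
    ... | no b≢d  | no ¬abd | no ¬cbd = inj₂ (inj₁
        ( dep-swap₂₃ (planeIndex-dep a≢c eq)
        , proj₁ m ∘ col-swap₂₃ , ¬abd , proj₁ m′ , ¬cbd ∘ col-swap₁₂ ))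
      where
      a≢c : a ≢ c
      a≢c refl = proj₁ m (col-repeat₁₂ a b)

    -- The cubic term is the diagonal b = d. The two kinds of bad quadruples have the same total
    -- because a and c can be renamed into each other.
    pairs-bound : #pairs ≤ n * (n * (n * 1)) + (#good + (#bad + #bad))
    pairs-bound = begin
      #pairs
        ≤⟨ ∑⁴-mono-≤ pointwise ⟩
      ∑⁴ (λ a c b d → E b d + (G a b c d + (B a b c d + B c b a d)))
        ≡⟨ ∑⁴-distrib-+ {n} (λ a c b d → E b d) (λ a c b d → G a b c d + (B a b c d + B c b a d)) ⟩
      ∑⁴ {n} (λ a c b d → E b d) + ∑⁴ (λ a c b d → G a b c d + (B a b c d + B c b a d))
        ≡⟨ cong₂ _+_ diagonal (trans (∑⁴-distrib-+ {n} (λ a c b d → G a b c d) (λ a c b d → B a b c d + B c b a d))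
             (cong₂ _+_ (sym (∑⁴-swap₂₃ G)) (trans (∑⁴-distrib-+ {n} (λ a c b d → B a b c d) (λ a c b d → B c b a d))
               (cong₂ _+_ (sym (∑⁴-swap₂₃ B)) (trans (∑⁴-swap₁₂ (λ a c b d → B c b a d)) (sym (∑⁴-swap₂₃ B))))))) ⟩
      n * (n * (n * 1)) + (#good + (#bad + #bad)) ∎
      where
      open ≤-Reasoning
      E : Fin n → Fin n → ℕ
      E b d = χ (b ≟ᶠ d)
      G = λ a b c d → χ (good? a b c d)
      B = λ a b c d → χ (bad? a b c d)
      pointwise : ∀ a c b d →
        χ (marked? a c b ×-dec marked? a c d ×-dec planeIndex a c b ≟ᶠ planeIndex a c d) ≤
        E b d + (G a b c d + (B a b c d + B c b a d))
      pointwise a c b d = χ-≤ (marked? a c b ×-dec marked? a c d ×-dec planeIndex a c b ≟ᶠ planeIndex a c d)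
        λ (m , m′ , eq) → case (coplanar-apices m m′ eq)
        where
        case : b ≡ d ⊎ Good a b c d ⊎ Bad a b c d ⊎ Bad c b a d → 1 ≤ E b d + (G a b c d + (B a b c d + B c b a d))
        case (inj₁ e)               = m≤n⇒m≤n+o _ (1≤χ (b ≟ᶠ d) e)
        case (inj₂ (inj₁ g))        = m≤n⇒m≤o+n (E b d) (m≤n⇒m≤n+o _ (1≤χ (good? a b c d) g))
        case (inj₂ (inj₂ (inj₁ u))) = m≤n⇒m≤o+n (E b d) (m≤n⇒m≤o+n (G a b c d) (m≤n⇒m≤n+o _ (1≤χ (bad? a b c d) u)))
        case (inj₂ (inj₂ (inj₂ u))) = m≤n⇒m≤o+n (E b d) (m≤n⇒m≤o+n (G a b c d) (m≤n⇒m≤o+n (B a b c d) (1≤χ (bad? c b a d) u)))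
      row : ∀ b → ∑[ d < n ] χ (b ≟ᶠ d) ≡ 1
      row b = ≤-antisym (sum-χ-unique (b ≟ᶠ_) (λ _ _ u v → trans (sym u) v) (λ _ _ → ≤-refl))
                (≤-trans (1≤χ (b ≟ᶠ b) refl) (term≤sum _ b))
      diagonal : ∑⁴ {n} (λ a c b d → E b d) ≡ n * (n * (n * 1))
      diagonal = trans (sum-cong-≗ {n} λ a → trans (sum-cong-≗ {n} λ c → trans (sum-cong-≗ row) (sum-const n 1))
                   (sum-const n (n * 1))) (sum-const n (n * (n * 1)))

    -- Replacing a by a further point a′ of the line a c turns a bad quadruple into
    -- a good one, and a is recovered as the intersection of the lines b d and c a′.
    bad⇒good : ∀ {a b c d a′} → Bad a b c d → Third a c a′ → Good a′ b c d
    bad⇒good {a} {b} {c} {d} {a′} (_ , bda , a≢b , a≢d , b≢d , ¬bdc) (a′≢a , a′≢c , aca′) =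
      dep-onLine a≢c (col-swap₁₂ aca′) bda ,
      ¬a′bc , ¬a′bd , ¬a′cd , ¬bdc ∘ col-swap₂₃
      where
      a≢c : a ≢ c
      a≢c refl = ¬bdc bda
      ¬abc : ¬ Col a b c
      ¬abc abc = ¬bdc (col-onLine a≢b (col-repeat a b) (col-swap₁₂ (col-swap₂₃ bda)) abc)
      ¬adc : ¬ Col a d c
      ¬adc adc = ¬bdc (col-onLine a≢d (col-swap₁₂ (col-swap₂₃ (col-swap₁₂ bda))) (col-repeat a d) adc)
      a′ca : Col a′ c a
      a′ca = col-swap₂₃ (col-swap₁₂ (col-swap₂₃ aca′))
      ¬a′bc : ¬ Col a′ b c
      ¬a′bc a′bc = ¬abc (col-onLine a′≢c a′ca (col-swap₂₃ a′bc) (col-repeat a′ c))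
      ¬a′cd : ¬ Col a′ c d
      ¬a′cd a′cd = ¬adc (col-onLine a′≢c a′ca a′cd (col-repeat a′ c))
      ¬a′bd : ¬ Col a′ b d
      -- If a′ were on bd, where a already lies, then b would lie on the line aa′, which also
      -- contains c.
      ¬a′bd a′bd = ¬a′bc (col-onLine (a′≢a ∘ sym) (col-repeat a a′) aa′b (col-swap₂₃ aca′))
        where
        aa′b : Col a a′ b
        aa′b = col-onLine b≢d bda (col-swap₂₃ (col-swap₁₂ a′bd)) (col-repeat₁₃ b d)

    -- Two distinct solutions would span both the line bd and the line ca′, which puts c on bd.
    bad-unique : ∀ {a₁ a₂ b c d a′} → Bad a₁ b c d × Third a₁ c a′ → Bad a₂ b c d × Third a₂ c a′ → a₁ ≡ a₂
    bad-unique {a₁} {a₂} {b} {c} {d} {a′} ((_ , bda₁ , _ , _ , b≢d , ¬bdc) , (_ , a′≢c , a₁ca′)) ((_ , bda₂ , _) , (_ , _ , a₂ca′))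
      with a₁ ≟ᶠ a₂
    ... | yes a₁≡a₂ = a₁≡a₂
    ... | no a₁≢a₂ = contradiction (col-onLine a₁≢a₂ (on b (col-repeat₁₃ b d)) (on d (col-repeat b d)) a₁a₂c) ¬bdc
      where
      on : ∀ x → Col b d x → Col a₁ a₂ x
      on x bdx = col-onLine b≢d bda₁ bda₂ bdx
      a₁a₂c : Col a₁ a₂ c
      a₁a₂c = col-onLine a′≢c (col-swap₂₃ (col-swap₁₂ (col-swap₂₃ a₁ca′))) (col-swap₂₃ (col-swap₁₂ (col-swap₂₃ a₂ca′))) (col-repeat a′ c)

    -- For fixed b, c, d the pairs (a, a′) are double counted: a bad a has at least one a′, while an
    -- a′ comes from at most one a and is then good.
    bad≤good : #bad ≤ #good
    bad≤good = begin
      #bad                                        ≡⟨ last-first (λ a b c d → χ (bad? a b c d)) ⟩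
      ∑⁴ (λ b c d a → χ (bad? a b c d))           ≤⟨ ∑³-mono-≤ bound ⟩
      ∑⁴ (λ b c d a → χ (good? a b c d))          ≡⟨ last-first (λ a b c d → χ (good? a b c d)) ⟨
      #good                                       ∎
      where
      open ≤-Reasoning
      last-first : ∀ f → ∑⁴ f ≡ ∑⁴ {n} (λ b c d a → f a b c d)
      last-first f = trans (∑⁴-swap₁₂ f) (trans (∑⁴-swap₂₃ (λ b a c d → f a b c d)) (∑⁴-swap₃₄ (λ b c a d → f a b c d)))
      bound : ∀ b c d → ∑[ a < n ] χ (bad? a b c d) ≤ ∑[ a < n ] χ (good? a b c d)
      bound b c d = begin
        ∑[ a < n ] χ (bad? a b c d)
          ≤⟨ sum-mono-≤ (λ a → χ-≤ (bad? a b c d) λ bad → let (a′ , t) = proj₁ bad in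
               ≤-trans (1≤χ (bad? a b c d ×-dec third? a c a′) (bad , t))
                 (term≤sum (λ a′ → χ (bad? a b c d ×-dec third? a c a′)) a′)) ⟩
        ∑[ a < n ] ∑[ a′ < n ] χ (bad? a b c d ×-dec third? a c a′)
          ≡⟨ ∑-comm (λ a a′ → χ (bad? a b c d ×-dec third? a c a′)) ⟩
        ∑[ a′ < n ] ∑[ a < n ] χ (bad? a b c d ×-dec third? a c a′)
          ≤⟨ sum-mono-≤ (λ a′ → sum-χ-unique (λ a → bad? a b c d ×-dec third? a c a′)
               (λ _ _ → bad-unique) (λ a (bad , t) → 1≤χ (good? a′ b c d) (bad⇒good bad t))) ⟩
        ∑[ a′ < n ] χ (good? a′ b c d) ∎

    pairs≤good : #pairs ≤ n * (n * n) + 3 * #good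
    pairs≤good = begin
      #pairs                                            ≤⟨ pairs-bound ⟩
      n * (n * (n * 1)) + (#good + (#bad + #bad))       ≤⟨ +-monoʳ-≤ (n * (n * (n * 1))) (+-monoʳ-≤ #good (+-mono-≤ bad≤good bad≤good)) ⟩
      n * (n * (n * 1)) + (#good + (#good + #good))     ≡⟨ solve 2 (λ n g → n :* (n :* (n :* con 1)) :+ (g :+ (g :+ g)) :=
                                                             n :* (n :* n) :+ con 3 :* g) refl n #good ⟩
      n * (n * n) + 3 * #good                           ∎
      where
      open ≤-Reasoning
      open +-*-Solver

    -- The same κ and μ serve for every side, so the estimate averages over the n² ordered sides and
    -- over the q + 1 planes through each of them at once.
    pairs-lower-bound : ∀ κ μ → 2 * (κ * μ) * #marked ≤ κ * κ * #pairs + n * (n * (suc q * (μ * μ)))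
    pairs-lower-bound κ μ = begin
      2 * (κ * μ) * #marked
        ≡⟨ trans (*-distribˡ-sum (2 * (κ * μ)) (λ a → ∑[ c < n ] τ a c)) (sum-cong-≗ λ a → *-distribˡ-sum (2 * (κ * μ)) (τ a)) ⟩
      ∑² (λ a c → 2 * (κ * μ) * τ a c)
        ≤⟨ ∑²-mono-≤ (λ a c → pairs-in-classes (marked? a c) (planeIndex a c) κ μ) ⟩
      ∑² (λ a c → κ * κ * ω a c + suc q * (μ * μ))
        ≡⟨ ∑²-distrib-+ (λ a c → κ * κ * ω a c) (λ _ _ → suc q * (μ * μ)) ⟩
      ∑² (λ a c → κ * κ * ω a c) + ∑² {n} (λ _ _ → suc q * (μ * μ))
        ≡⟨ cong₂ _+_ (sym (trans (*-distribˡ-sum (κ * κ) (λ a → ∑[ c < n ] ω a c)) (sum-cong-≗ λ a → *-distribˡ-sum (κ * κ) (ω a))))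
             (trans (sum-cong-≗ {n} λ _ → sum-const n _) (sum-const n _)) ⟩
      κ * κ * #pairs + n * (n * (suc q * (μ * μ))) ∎
      where
      open ≤-Reasoning
      τ : Fin n → Fin n → ℕ
      τ a c = ∑[ b < n ] χ (marked? a c b)
      ω : Fin n → Fin n → ℕ
      ω a c = ∑[ b < n ] ∑[ d < n ] χ (marked? a c b ×-dec marked? a c d ×-dec planeIndex a c b ≟ᶠ planeIndex a c d)

    -- With m = q + 1, the estimate n⁴ ≤ 36 m `#pairs` loses 36 m n³ to the diagonal b = d. This is
    -- at most half of n⁴ as soon as 72 m ≤ n.
    many-good : 72 * suc q ≤ n → n ^ 4 ≤ 216 * (suc q * #good)
    many-good 72m≤n = subst (_≤ 216 * (m * #good)) (solve 1 (λ n → n :* (n :* (n :* n)) := n :^ 4) refl n)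
      (+-cancelʳ-≤ (n * (n * (n * n))) _ _ (begin
        n * (n * (n * n)) + n * (n * (n * n))
          ≡⟨ solve 1 (λ x → x :+ x := con 2 :* x) refl (n * (n * (n * n))) ⟩
        2 * (n * (n * (n * n)))
          ≤⟨ *-monoʳ-≤ 2 n⁴≤36m#pairs ⟩
        2 * (36 * (m * #pairs))
          ≤⟨ *-monoʳ-≤ 2 (*-monoʳ-≤ 36 (*-monoʳ-≤ m pairs≤good)) ⟩
        2 * (36 * (m * (n * (n * n) + 3 * #good)))
          ≡⟨ solve 3 (λ m n g → con 2 :* (con 36 :* (m :* (n :* (n :* n) :+ con 3 :* g))) :=
               con 216 :* (m :* g) :+ con 72 :* m :* (n :* (n :* n))) refl m n #good ⟩
        216 * (m * #good) + 72 * m * (n * (n * n))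
          ≤⟨ +-monoʳ-≤ (216 * (m * #good)) (*-monoˡ-≤ (n * (n * n)) 72m≤n) ⟩
        216 * (m * #good) + n * (n * (n * n)) ∎))
      where
      open ≤-Reasoning
      open +-*-Solver
      m = suc q
      2m≤n : 2 * m ≤ n
      2m≤n = ≤-trans (*-monoˡ-≤ m {2} {72} (s≤s (s≤s z≤n))) 72m≤n
      -- At most n² m ≤ n³/2 triples are collinear; the factor 3 for the position of the marked side
      -- makes 6.
      n³≤6#marked : n * (n * n) ≤ 6 * #marked
      n³≤6#marked = +-cancelʳ-≤ (n * (n * n)) _ _ (begin
        n * (n * n) + n * (n * n)
          ≡⟨ solve 1 (λ x → x :+ x := con 2 :* x) refl (n * (n * n)) ⟩
        2 * (n * (n * n))
          ≤⟨ *-monoʳ-≤ 2 triples ⟩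
        2 * (3 * #marked + n * (n * m))
          ≡⟨ solve 3 (λ t n m → con 2 :* (con 3 :* t :+ n :* (n :* m)) := con 6 :* t :+ n :* (n :* (con 2 :* m))) refl #marked n m ⟩
        6 * #marked + n * (n * (2 * m))
          ≤⟨ +-monoʳ-≤ (6 * #marked) (*-monoʳ-≤ n (*-monoʳ-≤ n 2m≤n)) ⟩
        6 * #marked + n * (n * n) ∎)
      n⁴≤36m#pairs : n * (n * (n * n)) ≤ 36 * (m * #pairs)
      n⁴≤36m#pairs = *-cancelˡ-≤ m (+-cancelʳ-≤ (m * (n * (n * (n * n)))) _ _ (begin
        m * (n * (n * (n * n))) + m * (n * (n * (n * n)))
          ≡⟨ solve 2 (λ m n → m :* (n :* (n :* (n :* n))) :+ m :* (n :* (n :* (n :* n))) :=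
               con 2 :* (m :* n) :* (n :* (n :* n))) refl m n ⟩
        2 * (m * n) * (n * (n * n))
          ≤⟨ *-monoʳ-≤ (2 * (m * n)) n³≤6#marked ⟩
        2 * (m * n) * (6 * #marked)
          ≡⟨ solve 3 (λ m n t → con 2 :* (m :* n) :* (con 6 :* t) := con 2 :* (con 6 :* m :* n) :* t) refl m n #marked ⟩
        2 * (6 * m * n) * #marked
          -- The ratio μ/κ = n/(6m) is the lower bound for the average class size, since at least
          -- n³/6 marked triples fall into n² m classes.
          ≤⟨ pairs-lower-bound (6 * m) n ⟩
        6 * m * (6 * m) * #pairs + n * (n * (m * (n * n)))
          ≡⟨ solve 3 (λ m n w → con 6 :* m :* (con 6 :* m) :* w :+ n :* (n :* (m :* (n :* n))) :=
               m :* (con 36 :* (m :* w)) :+ m :* (n :* (n :* (n :* n)))) refl m n #pairs ⟩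
        m * (36 * (m * #pairs)) + m * (n * (n * (n * n))) ∎))

  -- From ordered quadruples to increasing ones.

  module Sorting {n : ℕ} {R : Fin n → Fin n → Fin n → Fin n → Set} (r? : ∀ a b c d → Dec (R a b c d))
    (swap₁₂ : ∀ {a b c d} → R a b c d → R b a c d)
    (swap₂₃ : ∀ {a b c d} → R a b c d → R a c b d)
    (swap₃₄ : ∀ {a b c d} → R a b c d → R a b d c)
    (irrefl₁₂ : ∀ {a b c d} → R a b c d → a ≢ b)
    where

    irrefl₁₃ : ∀ {a b c d} → R a b c d → a ≢ c
    irrefl₁₃ = irrefl₁₂ ∘ swap₂₃

    irrefl₂₃ : ∀ {a b c d} → R a b c d → b ≢ c
    irrefl₂₃ = irrefl₁₃ ∘ swap₁₂

    irrefl₁₄ : ∀ {a b c d} → R a b c d → a ≢ d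
    irrefl₁₄ = irrefl₁₃ ∘ swap₃₄

    irrefl₂₄ : ∀ {a b c d} → R a b c d → b ≢ d
    irrefl₂₄ = irrefl₁₄ ∘ swap₁₂

    irrefl₃₄ : ∀ {a b c d} → R a b c d → c ≢ d
    irrefl₃₄ = irrefl₂₄ ∘ swap₂₃

    -- The stages of an insertion sort: the first two, three, four entries are increasing. Inserting
    -- the next entry has 2, 3, then 4 possible places, whence the factor 24.
    Sorted₂ Sorted₃ Sorted₄ : Fin n → Fin n → Fin n → Fin n → Set
    Sorted₂ a b c d = a < b × R a b c d
    Sorted₃ a b c d = b < c × Sorted₂ a b c d
    Sorted₄ a b c d = c < d × Sorted₃ a b c d

    sorted₂? : ∀ a b c d → Dec (Sorted₂ a b c d)
    sorted₂? a b c d = a <? b ×-dec r? a b c d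

    sorted₃? : ∀ a b c d → Dec (Sorted₃ a b c d)
    sorted₃? a b c d = b <? c ×-dec sorted₂? a b c d

    sorted₄? : ∀ a b c d → Dec (Sorted₄ a b c d)
    sorted₄? a b c d = c <? d ×-dec sorted₃? a b c d

    X X₂ X₃ X₄ : Fin n → Fin n → Fin n → Fin n → ℕ
    X  a b c d = χ (r? a b c d)
    X₂ a b c d = χ (sorted₂? a b c d)
    X₃ a b c d = χ (sorted₃? a b c d)
    X₄ a b c d = χ (sorted₄? a b c d)

    sort₂ : ∑⁴ X ≤ 2 * ∑⁴ X₂
    sort₂ = begin
      ∑⁴ X
        ≤⟨ ∑⁴-mono-≤ (λ a b c d → χ-≤ (r? a b c d) (insert a b c d)) ⟩
      ∑⁴ (λ a b c d → X₂ a b c d + X₂ b a c d)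
        ≡⟨ ∑⁴-distrib-+ X₂ (λ a b c d → X₂ b a c d) ⟩
      ∑⁴ X₂ + ∑⁴ (λ a b c d → X₂ b a c d)
        ≡⟨ cong (∑⁴ X₂ +_) (∑⁴-swap₁₂ X₂) ⟨
      ∑⁴ X₂ + ∑⁴ X₂
        ≡⟨ solve 1 (λ x → x :+ x := con 2 :* x) refl (∑⁴ X₂) ⟩
      2 * ∑⁴ X₂ ∎
      where
      open ≤-Reasoning
      open +-*-Solver
      insert : ∀ a b c d → R a b c d → 1 ≤ X₂ a b c d + X₂ b a c d
      insert a b c d r with <-cmp a b
      ... | tri< a<b _ _ = m≤n⇒m≤n+o _ (1≤χ (sorted₂? a b c d) (a<b , r))
      ... | tri≈ _ a≡b _ = contradiction a≡b (irrefl₁₂ r)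
      ... | tri> _ _ b<a = m≤n⇒m≤o+n (X₂ a b c d) (1≤χ (sorted₂? b a c d) (b<a , swap₁₂ r))

    sort₃ : ∑⁴ X₂ ≤ 3 * ∑⁴ X₃
    sort₃ = begin
      ∑⁴ X₂
        ≤⟨ ∑⁴-mono-≤ (λ a b c d → χ-≤ (sorted₂? a b c d) (insert a b c d)) ⟩
      ∑⁴ (λ a b c d → X₃ a b c d + (X₃ a c b d + X₃ c a b d))
        ≡⟨ ∑⁴-distrib-+ X₃ (λ a b c d → X₃ a c b d + X₃ c a b d) ⟩
      ∑⁴ X₃ + ∑⁴ (λ a b c d → X₃ a c b d + X₃ c a b d)
        ≡⟨ cong (∑⁴ X₃ +_) (∑⁴-distrib-+ (λ a b c d → X₃ a c b d) (λ a b c d → X₃ c a b d)) ⟩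
      ∑⁴ X₃ + (∑⁴ (λ a b c d → X₃ a c b d) + ∑⁴ (λ a b c d → X₃ c a b d))
        ≡⟨ cong (∑⁴ X₃ +_) (cong₂ _+_ (∑⁴-swap₂₃ X₃)
             (trans (∑⁴-swap₁₂ X₃) (∑⁴-swap₂₃ (λ a b c d → X₃ b a c d)))) ⟨
      ∑⁴ X₃ + (∑⁴ X₃ + ∑⁴ X₃)
        ≡⟨ solve 1 (λ x → x :+ (x :+ x) := con 3 :* x) refl (∑⁴ X₃) ⟩
      3 * ∑⁴ X₃ ∎
      where
      open ≤-Reasoning
      open +-*-Solver
      insert : ∀ a b c d → Sorted₂ a b c d → 1 ≤ X₃ a b c d + (X₃ a c b d + X₃ c a b d)
      insert a b c d (a<b , r) with <-cmp b c | <-cmp a c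
      ... | tri< b<c _ _ | _            = m≤n⇒m≤n+o _ (1≤χ (sorted₃? a b c d) (b<c , a<b , r))
      ... | tri≈ _ b≡c _ | _            = contradiction b≡c (irrefl₂₃ r)
      ... | tri> _ _ c<b | tri≈ _ a≡c _ = contradiction a≡c (irrefl₁₃ r)
      ... | tri> _ _ c<b | tri< a<c _ _ = m≤n⇒m≤o+n (X₃ a b c d) (m≤n⇒m≤n+o _
        (1≤χ (sorted₃? a c b d) (c<b , a<c , swap₂₃ r)))
      ... | tri> _ _ c<b | tri> _ _ c<a = m≤n⇒m≤o+n (X₃ a b c d) (m≤n⇒m≤o+n (X₃ a c b d)
        (1≤χ (sorted₃? c a b d) (a<b , c<a , swap₁₂ (swap₂₃ r))))

    sort₄ : ∑⁴ X₃ ≤ 4 * ∑⁴ X₄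
    sort₄ = begin
      ∑⁴ X₃
        ≤⟨ ∑⁴-mono-≤ (λ a b c d → χ-≤ (sorted₃? a b c d) (insert a b c d)) ⟩
      ∑⁴ (λ a b c d → X₄ a b c d + (X₄ a b d c + (X₄ a d b c + X₄ d a b c)))
        ≡⟨ ∑⁴-distrib-+ X₄ (λ a b c d → X₄ a b d c + (X₄ a d b c + X₄ d a b c)) ⟩
      ∑⁴ X₄ + ∑⁴ (λ a b c d → X₄ a b d c + (X₄ a d b c + X₄ d a b c))
        ≡⟨ cong (∑⁴ X₄ +_) (trans (∑⁴-distrib-+ (λ a b c d → X₄ a b d c) (λ a b c d → X₄ a d b c + X₄ d a b c))
             (cong (∑⁴ (λ a b c d → X₄ a b d c) +_) (∑⁴-distrib-+ (λ a b c d → X₄ a d b c) (λ a b c d → X₄ d a b c)))) ⟩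
      ∑⁴ X₄ + (∑⁴ (λ a b c d → X₄ a b d c) + (∑⁴ (λ a b c d → X₄ a d b c) + ∑⁴ (λ a b c d → X₄ d a b c)))
        ≡⟨ cong (∑⁴ X₄ +_) (cong₂ _+_ (∑⁴-swap₃₄ X₄) (cong₂ _+_
             (trans (∑⁴-swap₂₃ X₄) (∑⁴-swap₃₄ (λ a b c d → X₄ a c b d)))
             (trans (∑⁴-swap₁₂ X₄) (trans (∑⁴-swap₂₃ (λ a b c d → X₄ b a c d)) (∑⁴-swap₃₄ (λ a b c d → X₄ c a b d)))))) ⟨
      ∑⁴ X₄ + (∑⁴ X₄ + (∑⁴ X₄ + ∑⁴ X₄))
        ≡⟨ solve 1 (λ x → x :+ (x :+ (x :+ x)) := con 4 :* x) refl (∑⁴ X₄) ⟩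
      4 * ∑⁴ X₄ ∎
      where
      open ≤-Reasoning
      open +-*-Solver
      insert : ∀ a b c d → Sorted₃ a b c d → 1 ≤ X₄ a b c d + (X₄ a b d c + (X₄ a d b c + X₄ d a b c))
      insert a b c d (b<c , a<b , r) with <-cmp c d | <-cmp b d | <-cmp a d
      ... | tri< c<d _ _ | _            | _ = m≤n⇒m≤n+o _ (1≤χ (sorted₄? a b c d) (c<d , b<c , a<b , r))
      ... | tri≈ _ c≡d _ | _            | _ = contradiction c≡d (irrefl₃₄ r)
      ... | tri> _ _ _   | tri≈ _ b≡d _ | _ = contradiction b≡d (irrefl₂₄ r)
      ... | tri> _ _ _   | tri> _ _ _   | tri≈ _ a≡d _ = contradiction a≡d (irrefl₁₄ r)
      ... | tri> _ _ d<c | tri< b<d _ _ | _ = m≤n⇒m≤o+n (X₄ a b c d) (m≤n⇒m≤n+o _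
        (1≤χ (sorted₄? a b d c) (d<c , b<d , a<b , swap₃₄ r)))
      ... | tri> _ _ d<c | tri> _ _ d<b | tri< a<d _ _ = m≤n⇒m≤o+n (X₄ a b c d) (m≤n⇒m≤o+n (X₄ a b d c) (m≤n⇒m≤n+o _
        (1≤χ (sorted₄? a d b c) (b<c , d<b , a<d , swap₂₃ (swap₃₄ r)))))
      ... | tri> _ _ d<c | tri> _ _ d<b | tri> _ _ d<a = m≤n⇒m≤o+n (X₄ a b c d) (m≤n⇒m≤o+n (X₄ a b d c) (m≤n⇒m≤o+n (X₄ a d b c)
        (1≤χ (sorted₄? d a b c) (b<c , a<b , d<a , swap₁₂ (swap₂₃ (swap₃₄ r))))))

    sort : ∑⁴ X ≤ 24 * ∑⁴ X₄
    sort = begin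
      ∑⁴ X                      ≤⟨ sort₂ ⟩
      2 * ∑⁴ X₂                 ≤⟨ *-monoʳ-≤ 2 sort₃ ⟩
      2 * (3 * ∑⁴ X₃)           ≤⟨ *-monoʳ-≤ 2 (*-monoʳ-≤ 3 sort₄) ⟩
      2 * (3 * (4 * ∑⁴ X₄))     ≡⟨ solve 1 (λ x → con 2 :* (con 3 :* (con 4 :* x)) := con 24 :* x) refl (∑⁴ X₄) ⟩
      24 * ∑⁴ X₄                ∎
      where
      open ≤-Reasoning
      open +-*-Solver

  -- Lengths of filtered lists as indicator sums.

  length-filter-map : ∀ {A B : Set} {P : Pred B 0ℓ} (P? : Decidable P) (f : A → B) xs →
                      length (filter P? (map f xs)) ≡ length (filter (P? ∘ f) xs)
  length-filter-map P? f []       = refl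
  length-filter-map P? f (x ∷ xs) with P? (f x)
  ... | yes _ = cong suc (length-filter-map P? f xs)
  ... | no _  = length-filter-map P? f xs

  length-filter-tabulate : ∀ {A : Set} {P : Pred A 0ℓ} (P? : Decidable P) {n} (f : Fin n → A) →
                           length (filter P? (tabulate f)) ≡ ∑[ i < n ] χ (P? (f i))
  length-filter-tabulate P? {zero}  f = refl
  length-filter-tabulate P? {suc n} f with P? (f zero)
  ... | yes _ = cong suc (length-filter-tabulate P? (f ∘ suc))
  ... | no _  = length-filter-tabulate P? (f ∘ suc)

  length-filter-product : ∀ {A B : Set} {P : Pred (A × B) 0ℓ} (P? : Decidable P) {n} (f : Fin n → A) ys →
    length (filter P? (cartesianProduct (tabulate f) ys)) ≡ ∑[ i < n ] length (filter (λ y → P? (f i , y)) ys)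
  length-filter-product P? {zero}  f ys = refl
  length-filter-product P? {suc n} f ys = begin
    length (filter P? (map (f zero ,_) ys ++ rest))
      ≡⟨ cong length (filter-++ P? (map (f zero ,_) ys) rest) ⟩
    length (filter P? (map (f zero ,_) ys) ++ filter P? rest)
      ≡⟨ length-++ (filter P? (map (f zero ,_) ys)) ⟩
    length (filter P? (map (f zero ,_) ys)) + length (filter P? rest)
      ≡⟨ cong₂ _+_ (length-filter-map P? (f zero ,_) ys) (length-filter-product P? (f ∘ suc) ys) ⟩
    ∑[ i < suc n ] length (filter (λ y → P? (f i , y)) ys) ∎
    where
    open ≡-Reasoning
    rest = cartesianProduct (tabulate (f ∘ suc)) ys

  Fin⁴ : ℕ → Set
  Fin⁴ n = Fin n × Fin n × Fin n × Fin n

  allFin⁴ : ∀ n → List (Fin⁴ n)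
  allFin⁴ n = cartesianProduct (allFin n) (cartesianProduct (allFin n) (cartesianProduct (allFin n) (allFin n)))

  allFin⁴-unique : ∀ n → Unique (allFin⁴ n)
  allFin⁴-unique n = Unique.cartesianProduct⁺ u (Unique.cartesianProduct⁺ u (Unique.cartesianProduct⁺ u u))
    where u = Unique.allFin⁺ n

  length-filter-allFin⁴ : ∀ {n} {P : Pred (Fin⁴ n) 0ℓ} (P? : Decidable P) →
    length (filter P? (allFin⁴ n)) ≡ ∑⁴ (λ a b c d → χ (P? (a , b , c , d)))
  length-filter-allFin⁴ {n} P? =
    trans (length-filter-product P? {n} id _) (sum-cong-≗ λ a →
    trans (length-filter-product (λ y → P? (a , y)) {n} id _) (sum-cong-≗ λ b →
    trans (length-filter-product (λ y → P? (a , b , y)) {n} id _) (sum-cong-≗ λ c →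
    length-filter-tabulate (λ y → P? (a , b , c , y)) {n} id)))

  module _ {A B : Set} {P : Pred A 0ℓ} (f : ∀ {x} → P x → B) where

    ∈-reduce⁻ : ∀ {xs y} (pxs : All P xs) → y ∈ reduce f pxs → ∃ λ x → Σ (P x) λ px → y ≡ f px
    ∈-reduce⁻ (px ∷ _)   (here refl) = _ , px , refl
    ∈-reduce⁻ (_  ∷ pxs) (there y∈)  = ∈-reduce⁻ pxs y∈

    map-reduce : (g : B → A) → (∀ {x} (px : P x) → g (f px) ≡ x) → ∀ {xs} (pxs : All P xs) → map g (reduce f pxs) ≡ xs
    map-reduce g gf []         = refl
    map-reduce g gf (px ∷ pxs) = cong₂ _∷_ (gf px) (map-reduce g gf pxs)

  lookup-injective : ∀ {A : Set} {xs : List A} → Unique xs → ∀ i j → lookup xs i ≡ lookup xs j → i ≡ j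
  lookup-injective (_ ∷ _)     zero    zero    _ = refl
  lookup-injective (x∉xs ∷ _)  zero    (suc j) e = contradiction e (All.lookup x∉xs (∈-lookup j))
  lookup-injective (x∉xs ∷ _)  (suc i) zero    e = contradiction (sym e) (All.lookup x∉xs (∈-lookup i))
  lookup-injective (_ ∷ xs!)   (suc i) (suc j) e = cong suc (lookup-injective xs! i j e)

  -- The configuration of a point set and its list of quadruples.

  module PointSet (F : FiniteField) (P : List (Geometry.Pt F)) (P! : Unique P) where
    open FieldGeometry F
    open FiniteField F using (size)

    n = length P

    p : Fin n → Pt
    p = lookup P

    p-≢ : ∀ {a b} → a ≢ b → p a ≢ p b
    p-≢ a≢b e = a≢b (lookup-injective P! _ _ e)

    configuration : Configuration n size
    configuration = record
      { Col  = λ a b c → Collinear (p a) (p b) (p c)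
      ; col? = λ a b c → collinear? (p a) (p b) (p c)
      ; Dep  = λ a b c d → AffDep₄ (p a) (p b) (p c) (p d)
      ; dep? = λ a b c d → affDep₄? (p a) (p b) (p c) (p d)
      ; col-repeat = λ a b → collinear-repeat (p a) (p b)
      ; col-swap₁₂ = λ {a} {b} {c} → collinear-swap₁₂ {p a} {p b} {p c}
      ; col-swap₂₃ = λ {a} {b} {c} → collinear-swap₂₃ {p a} {p b} {p c}
      ; col-onLine = λ a≢b → collinear-onLine (p-≢ a≢b)
      ; dep-swap₁₂ = λ {a} {b} {c} {d} → affDep₄-swap₁₂ (p a) (p b) (p c) (p d)
      ; dep-swap₂₃ = λ {a} {b} {c} {d} → affDep₄-swap₂₃ (p a) (p b) (p c) (p d)
      ; dep-swap₃₄ = λ {a} {b} {c} {d} → affDep₄-swap₃₄ (p a) (p b) (p c) (p d)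
      ; dep-onLine = λ a≢c → affDep₄-onLine (p-≢ a≢c)
      ; lineIndex = λ a b c → lineIndex (p a) (p b) (p c)
      ; lineIndex-injective = λ a≢b abc abd e → lookup-injective P! _ _ (lineIndex-injective (p-≢ a≢b) abc abd e)
      ; planeIndex = λ a b c → planeIndex (p a) (p b) (p c)
      ; planeIndex-dep = λ {a} {b} {c} {d} a≢b → planeIndex-affDep₄ (p a) (p b) (p c) (p d) (p-≢ a≢b)
      }

    open Configuration configuration using (Good; good?; col-repeat; col-swap₁₂; col-swap₂₃; dep-swap₁₂; dep-swap₂₃; dep-swap₃₄)
    open Counting configuration using (#good; many-good; col-repeat₁₂)

    good-swap₁₂ : ∀ {a b c d} → Good a b c d → Good b a c d
    good-swap₁₂ (abcd , ¬abc , ¬abd , ¬acd , ¬bcd) =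
      dep-swap₁₂ abcd , ¬abc ∘ col-swap₁₂ , ¬abd ∘ col-swap₁₂ , ¬bcd , ¬acd

    good-swap₂₃ : ∀ {a b c d} → Good a b c d → Good a c b d
    good-swap₂₃ (abcd , ¬abc , ¬abd , ¬acd , ¬bcd) =
      dep-swap₂₃ abcd , ¬abc ∘ col-swap₂₃ , ¬acd , ¬abd , ¬bcd ∘ col-swap₁₂

    good-swap₃₄ : ∀ {a b c d} → Good a b c d → Good a b d c
    good-swap₃₄ (abcd , ¬abc , ¬abd , ¬acd , ¬bcd) =
      dep-swap₃₄ abcd , ¬abd , ¬abc , ¬acd ∘ col-swap₂₃ , ¬bcd ∘ col-swap₂₃

    good-irrefl₁₂ : ∀ {a b c d} → Good a b c d → a ≢ b
    good-irrefl₁₂ (_ , ¬abc , _) refl = ¬abc (col-repeat₁₂ _ _)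

    open Sorting good? good-swap₁₂ good-swap₂₃ good-swap₃₄ good-irrefl₁₂

    Sorted : Fin⁴ n → Set
    Sorted (a , b , c , d) = Sorted₄ a b c d

    sorted? : Decidable Sorted
    sorted? (a , b , c , d) = sorted₄? a b c d

    toQuad : ∀ {x} → Sorted x → Quad n
    toQuad {a , b , c , d} (c<d , b<c , a<b , _) = quad a b c d a<b b<c c<d

    fromQuad : Quad n → Fin⁴ n
    fromQuad (quad a b c d _ _ _) = a , b , c , d

    all-sorted : All Sorted (filter sorted? (allFin⁴ n))
    all-sorted = all-filter sorted? (allFin⁴ n)

    quads : List (Quad n)
    quads = reduce toQuad all-sorted

    map-fromQuad : map fromQuad quads ≡ filter sorted? (allFin⁴ n)
    map-fromQuad = map-reduce toQuad fromQuad (λ _ → refl) all-sorted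

    -- Order proofs inside a `Quad` need not be compared: `fromQuad` maps the list back to a
    -- duplicate-free list of tuples.
    quads-unique : Unique quads
    quads-unique = Unique.map⁻ (subst Unique (sym map-fromQuad) (Unique.filter⁺ sorted? (allFin⁴-unique n)))

    quads-critical : ∀ {Q} → Q ∈ quads → CriticalCoplanarQuad P Q
    quads-critical Q∈ with (a , b , c , d) , (_ , _ , _ , abcd , ¬abc , ¬abd , ¬acd , ¬bcd) , refl ← ∈-reduce⁻ toQuad all-sorted Q∈
      = affDep₄⇒coplanar ¬abc abcd , critical ¬abc ¬abd ¬acd ¬bcd

    length-quads : length quads ≡ ∑⁴ X₄
    length-quads = trans (sym (length-map fromQuad quads)) (trans (cong length map-fromQuad) (length-filter-allFin⁴ sorted?))

    many-quads : 72 * suc size ≤ n → n ^ 4 ≤ 5184 * (suc size * length quads)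
    many-quads large = begin
      n ^ 4                                   ≤⟨ many-good large ⟩
      216 * (suc size * #good)                ≤⟨ *-monoʳ-≤ 216 (*-monoʳ-≤ (suc size) sort) ⟩
      216 * (suc size * (24 * ∑⁴ X₄))         ≡⟨ cong (λ x → 216 * (suc size * (24 * x))) length-quads ⟨
      216 * (suc size * (24 * length quads))  ≡⟨ solve 2 (λ m t → con 216 :* (m :* (con 24 :* t)) := con 5184 :* (m :* t)) refl (suc size) (length quads) ⟩
      5184 * (suc size * length quads)        ∎
      where
      open ≤-Reasoning
      open +-*-Solver

  -- Passage from natural to rational inequalities.

  -- A normalised fraction does not reduce for a variable numerator, so the arithmetic of `toℚ` is
  -- done on unnormalised fractions with denominator 1 (the stored 0 is the denominator minus one).
  toℚᵘ-toℚ : ∀ a → ℚ.toℚᵘ (toℚ a) ℚᵘ.≃ ℚᵘ.mkℚᵘ (ℤ.+ a) 0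
  toℚᵘ-toℚ a = ℚ.toℚᵘ-fromℚᵘ (ℚᵘ.mkℚᵘ (ℤ.+ a) 0)

  toℚ-* : ∀ a b → toℚ a ℚ.* toℚ b ≡ toℚ (a * b)
  toℚ-* a b = ℚ.toℚᵘ-injective (begin-equality
    ℚ.toℚᵘ (toℚ a ℚ.* toℚ b)                            ≃⟨ ℚ.toℚᵘ-homo-* (toℚ a) (toℚ b) ⟩
    ℚ.toℚᵘ (toℚ a) ℚᵘ.* ℚ.toℚᵘ (toℚ b)                  ≃⟨ ℚᵘ.*-cong (toℚᵘ-toℚ a) (toℚᵘ-toℚ b) ⟩
    ℚᵘ.mkℚᵘ (ℤ.+ a) 0 ℚᵘ.* ℚᵘ.mkℚᵘ (ℤ.+ b) 0            ≡⟨ cong (λ x → ℚᵘ.mkℚᵘ x 0) (sym (ℤ.pos-* a b)) ⟩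
    ℚᵘ.mkℚᵘ (ℤ.+ (a * b)) 0                             ≃⟨ toℚᵘ-toℚ (a * b) ⟨
    ℚ.toℚᵘ (toℚ (a * b))                                ∎)
    where open ℚᵘ.≤-Reasoning

  toℚ-mono-≤ : ∀ {a b} → a ≤ b → toℚ a ℚ.≤ toℚ b
  toℚ-mono-≤ {a} {b} a≤b = ℚ.toℚᵘ-cancel-≤ (begin
    ℚ.toℚᵘ (toℚ a)     ≃⟨ toℚᵘ-toℚ a ⟩
    ℚᵘ.mkℚᵘ (ℤ.+ a) 0  ≤⟨ ℚᵘ.*≤* (ℤ.*-monoʳ-≤-nonNeg (ℤ.+ 1) (ℤ.+≤+ a≤b)) ⟩
    ℚᵘ.mkℚᵘ (ℤ.+ b) 0  ≃⟨ toℚᵘ-toℚ b ⟨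
    ℚ.toℚᵘ (toℚ b)     ∎)
    where open ℚᵘ.≤-Reasoning

  toℚ-cancel-≤ : ∀ {a b} → toℚ a ℚ.≤ toℚ b → a ≤ b
  toℚ-cancel-≤ {a} {b} a≤b = ℤ.drop‿+≤+ (ℤ.*-cancelʳ-≤-pos (ℤ.+ a) (ℤ.+ b) (ℤ.+ 1) (ℚᵘ.drop-*≤* (begin
    ℚᵘ.mkℚᵘ (ℤ.+ a) 0  ≃⟨ toℚᵘ-toℚ a ⟨
    ℚ.toℚᵘ (toℚ a)     ≤⟨ ℚ.toℚᵘ-mono-≤ a≤b ⟩
    ℚ.toℚᵘ (toℚ b)     ≃⟨ toℚᵘ-toℚ b ⟩
    ℚᵘ.mkℚᵘ (ℤ.+ b) 0  ∎)))
    where open ℚᵘ.≤-Reasoning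

  144q≤n⇒72[1+q]≤n : ∀ {q n} → 1 ≤ q → toℚ 144 ℚ.* toℚ q ℚ.≤ toℚ n → 72 * suc q ≤ n
  144q≤n⇒72[1+q]≤n {q} {n} 1≤q h = begin
    72 * (1 + q)  ≤⟨ *-monoʳ-≤ 72 (+-monoˡ-≤ q 1≤q) ⟩
    72 * (q + q)  ≡⟨ solve 1 (λ q → con 72 :* (q :+ q) := con 144 :* q) refl q ⟩
    144 * q       ≤⟨ toℚ-cancel-≤ (subst (ℚ._≤ toℚ n) (toℚ-* 144 q) h) ⟩
    n             ∎
    where
    open ≤-Reasoning
    open +-*-Solver

  1/10368-bound : ∀ {x q t} → 1 ≤ q → x ≤ 5184 * (suc q * t) →
                  (ℤ.+ 1 ℚ./ 10368) ℚ.* toℚ x ℚ.≤ toℚ t ℚ.* toℚ q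
  1/10368-bound {x} {q} {t} 1≤q h = begin
    c ℚ.* toℚ x                      ≤⟨ ℚ.*-monoˡ-≤-nonNeg c (toℚ-mono-≤ x≤) ⟩
    c ℚ.* toℚ (10368 * (t * q))      ≡⟨ cong (c ℚ.*_) (toℚ-* 10368 (t * q)) ⟨
    c ℚ.* (toℚ 10368 ℚ.* toℚ (t * q)) ≡⟨ ℚ.*-assoc c (toℚ 10368) (toℚ (t * q)) ⟨
    -- The product `c ℚ.* toℚ 10368` is closed and evaluates to 1.
    c ℚ.* toℚ 10368 ℚ.* toℚ (t * q)  ≡⟨ ℚ.*-identityˡ (toℚ (t * q)) ⟩
    toℚ (t * q)                      ≡⟨ toℚ-* t q ⟨
    toℚ t ℚ.* toℚ q                  ∎
    where
    c = ℤ.+ 1 ℚ./ 10368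
    x≤ : x ≤ 10368 * (t * q)
    x≤ = ≤R.begin
      x                        ≤R.≤⟨ h ⟩
      5184 * ((1 + q) * t)     ≤R.≤⟨ *-monoʳ-≤ 5184 (*-monoˡ-≤ t (+-monoˡ-≤ q 1≤q)) ⟩
      5184 * ((q + q) * t)     ≤R.≡⟨ solve 2 (λ q t → con 5184 :* ((q :+ q) :* t) := con 10368 :* (t :* q)) refl q t ⟩
      10368 * (t * q)          ≤R.∎
      where
      module ≤R = ≤-Reasoning
      open +-*-Solver
    open ℚ.≤-Reasoning

open import Data.Nat using (_^_)
open import Data.Rational using (ℚ; 0ℚ; _<_; _≤_; _*_)

theorem6p1 : Σ ℚ λ c → Σ ℚ λ c′ → 0ℚ < c × 0ℚ < c′ ×
    ((F : FiniteField) → let open Geometry F in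
    (P : List Pt) → Unique P →
    c * toℚ (FiniteField.size F) ≤ toℚ (length P) →
    Σ (List (Quad (length P))) λ T → CCQuadList P T ×
    (c′ * toℚ (length P ^ 4) ≤ toℚ (length T) * toℚ (FiniteField.size F)))
-- Here 144 = 2 · 72 and 10368 = 2 · 24 · 216: both factors 2 come from q + 1 ≤ 2q, and 24 counts
-- the orderings of a quadruple.
theorem6p1 = toℚ 144 , ℤ.+ 1 ℚ./ 10368 , ℚ.positive⁻¹ (toℚ 144) , ℚ.positive⁻¹ (ℤ.+ 1 ℚ./ 10368) , λ F P P! large →
  let open QuadrupleCounting
      open PointSet F P P!
      1≤q = FieldGeometry.1≤size F
  in quads , (quads-unique , quads-critical) ,
     1/10368-bound {length P ^ 4} {FiniteField.size F} {length quads} 1≤q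
       (many-quads (144q≤n⇒72[1+q]≤n {FiniteField.size F} {length P} 1≤q large))
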